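{- For every even integer $k \ge 6$ there exist infinitely many (pairwise non-isomorphic) $3$-connected cubic planar graphs $G$ of circumference at least $k$ such that $\mathcal{C}(G) \cap [k, 2k+2] = \emptyset$, i.e.\ $G$ contains no cycle whose length $\ell$ satisfies $k \le \ell \le 2k+2$.
   Context: All graphs are finite and simple. For a graph $G$, the cycle spectrum $\mathcal{C}(G)$ is the set of lengths of cycles in $G$. The circumference of $G$ is the length of a longest cycle in $G$. A graph is cubic if every vertex has degree $3$. -}

module Defs where

open import Data.Nat using (ℕ; zero; suc; _+_; _*_; _≤_; _<_)
open import Data.Bool using (Bool; true; false; if_then_else_)
open import Data.Fin using (Fin; zero; suc; toℕ; fromℕ; inject₁)
open import Data.Fin.Subset using (Subset; _∉_; ∣_∣)
open import Data.Product using (Σ; ∃; _×_; _,_; proj₁; proj₂)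
open import Relation.Binary.PropositionalEquality using (_≡_)
open import Relation.Nullary using (¬_)
open import Function.Definitions using (Injective)

record Graph : Set where
  field
    order  : ℕ
    adj    : Fin order → Fin order → Bool
    sym    : ∀ u v → adj u v ≡ adj v u
    irrefl : ∀ v → adj v v ≡ false
open Graph public

count : {m : ℕ} → (Fin m → Bool) → ℕ
count {zero}  p = 0
count {suc m} p = (if p zero then 1 else 0) + count (λ i → p (suc i))

degree : (G : Graph) → Fin (order G) → ℕ
degree G v = count (adj G v)

Cubic : Graph → Set
Cubic G = ∀ v → degree G v ≡ 3

next : {ℓ : ℕ} → Fin ℓ → Fin ℓ
next {suc zero}    zero    = zero
next {suc (suc ℓ)} zero    = suc zero
next {suc (suc ℓ)} (suc i) with next {suc ℓ} i
... | zero  = zero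
... | suc j = suc (suc j)

record Cycle (G : Graph) (ℓ : ℕ) : Set where
  field
    len≥3 : 3 ≤ ℓ
    vert  : Fin ℓ → Fin (order G)
    inj   : Injective _≡_ _≡_ vert
    edges : ∀ i → adj G (vert i) (vert (next i)) ≡ true

InCycleSpectrum : Graph → ℕ → Set
InCycleSpectrum G ℓ = Cycle G ℓ

CircumferenceAtLeast : Graph → ℕ → Set
CircumferenceAtLeast G k = Σ ℕ λ ℓ → k ≤ ℓ × Cycle G ℓ

record WalkAvoiding (G : Graph) (S : Subset (order G)) (u v : Fin (order G)) : Set where
  field
    len    : ℕ
    vert   : Fin (suc len) → Fin (order G)
    start  : vert zero ≡ u
    end    : vert (fromℕ len) ≡ v
    step   : ∀ (i : Fin len) → adj G (vert (inject₁ i)) (vert (suc i)) ≡ true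
    avoids : ∀ i → vert i ∉ S

ConnectedMinus : (G : Graph) → Subset (order G) → Set
ConnectedMinus G S = ∀ u v → u ∉ S → v ∉ S → WalkAvoiding G S u v

KConnected : ℕ → Graph → Set
KConnected k G = k < order G × (∀ (X : Subset (order G)) → ∣ X ∣ < k → ConnectedMinus G X)

iterate : {A : Set} → (A → A) → ℕ → A → A
iterate f zero    x = x
iterate f (suc k) x = f (iterate f k x)

-- Combinatorial (rotation-system) embedding: for each vertex v, rot v is a
-- cyclic permutation of the neighbourhood of v.
record RotationSystem (G : Graph) : Set where
  field
    rot     : Fin (order G) → Fin (order G) → Fin (order G)
    closed  : ∀ v u → adj G v u ≡ true → adj G v (rot v u) ≡ true
    cyclic  : ∀ v u w → adj G v u ≡ true → adj G v w ≡ true →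
              Σ ℕ λ k → iterate (rot v) k u ≡ w

faceStep : {G : Graph} → RotationSystem G →
           Fin (order G) × Fin (order G) → Fin (order G) × Fin (order G)
faceStep R (u , v) = v , RotationSystem.rot R v u

record HasFaces (G : Graph) (R : RotationSystem G) (F : ℕ) : Set where
  field
    face     : Fin (order G) → Fin (order G) → Fin F
    invar    : ∀ u v → adj G u v ≡ true →
               face v (RotationSystem.rot R v u) ≡ face u v
    sameOrb  : ∀ u v u' v' → adj G u v ≡ true → adj G u' v' ≡ true →
               face u v ≡ face u' v' →
               Σ ℕ λ k → iterate (faceStep R) k (u , v) ≡ (u' , v')
    surj     : ∀ (f : Fin F) → Σ (Fin (order G)) λ u → Σ (Fin (order G)) λ v →
               adj G u v ≡ true × face u v ≡ f

numDarts : Graph → ℕ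
numDarts G = sumDeg (order G) (degree G)
  where
  sumDeg : (m : ℕ) → (Fin m → ℕ) → ℕ
  sumDeg zero    d = 0
  sumDeg (suc m) d = d zero + sumDeg m (λ i → d (suc i))

-- Planar (for connected graphs): there is a rotation system of genus 0,
-- i.e. V − E + F = 2, written 2V + 2F = 2E + 4 = numDarts + 4.
Planar : Graph → Set
Planar G = Σ (RotationSystem G) λ R → Σ ℕ λ F →
           HasFaces G R F × (2 * order G + 2 * F ≡ numDarts G + 4)

record Iso (G H : Graph) : Set where
  field
    to      : Fin (order G) → Fin (order H)
    from    : Fin (order H) → Fin (order G)
    from-to : ∀ x → from (to x) ≡ x
    to-from : ∀ y → to (from y) ≡ y
    pres    : ∀ u v → adj H (to u) (to v) ≡ adj G u v

{-# OPTIONS --safe #-}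
-- Let k = 6 + 2 t. The graphs arise from a planar map H, made of five concentric
-- rings with c ≥ 8 + 2 t sectors, by replacing every vertex by a fragment with
-- k - 1 vertices: the vertex is truncated to a triangle, and then the corners
-- are truncated again and again, so that three ladder-like arms grow towards the
-- three neighbouring fragments. Truncation preserves cubic planar 3-connected
-- maps. A cycle inside a fragment has fewer than k vertices. Passing through a
-- fragment between two of its ends costs the lengths of the corresponding arms,
-- and the arm lengths, which only have to sum to 1 + t, are distributed so that
-- every cycle meeting several fragments has at least 2 k + 3 vertices: the
-- pentagons next to the two caps are too short by themselves, and the hexagons
-- between the rings have just enough room to make up for it.
--
-- The lower bound is certified by potentials. For every edge e of H there is a
-- function on the vertices that is 1-Lipschitz except across e (and across edges
-- that may be assumed absent from the cycle) and jumps by 2 k + 2 across e. Such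
-- a function is prescribed on the darts of H only, and extends over the
-- fragments by interpolation, one truncation at a time.

module Submission where

open import Defs
open import Data.Nat using (ℕ; zero; suc; _+_; _*_; _∸_; _≤_; _<_; z≤n; s≤s; _⊓_; _⊔_; pred; _≤?_;
  _<?_) renaming (_≟_ to _≟ℕ_)
open import Data.Nat.Properties using (≤-refl; ≤-trans; +-comm; +-identityʳ; +-assoc; m≤n⇒m≤1+n; m≤m+n;
  +-mono-≤; module ≤-Reasoning; +-suc; +-monoʳ-≤; +-monoˡ-≤; n≤1+n; +-cancelʳ-≡; <⇒≤; suc-injective;
  *-distribʳ-+; m+n≡0⇒m≡0; m+n≡0⇒n≡0; m∸n+n≡m; 0≢1+n; ≤-reflexive; m≤n+m; m⊓n≤m; m⊓n≤n; ⊓-glb; m≤m⊔n; m≤n⊔m;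
  ⊔-lub; m∸n≤m; m≤n+m∸n; m≤n+o⇒m∸n≤o; ≤-antisym; ≤-pred; <-≤-trans; n≮0; ≤-total; +-cancelˡ-≤; <⇒≱;
  *-identityʳ; *-monoˡ-≤; *-monoʳ-≤; m≤n⇒m<n∨m≡n; *-suc; n≮n; *-cancelʳ-≡; +-cancelˡ-≡; m≤m*n; *-identityˡ)
open import Data.Bool using (Bool; true; false; if_then_else_) renaming (_≟_ to _≟ᵇ_)
open import Data.Fin as Fin using (Fin; zero; suc; toℕ; fromℕ; fromℕ<; inject₁)
open import Data.Fin.Properties using (_≟_; injective⇒≤; toℕ-injective; toℕ<n; toℕ-fromℕ; toℕ-inject₁;
  toℕ-fromℕ<; any?; all?; *↔×; +↔⊎) renaming (suc-injective to fsuc-injective)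
open import Data.Fin.Relation.Unary.Top using (view; ‵fromℕ; ‵inject₁)
open import Data.Product using (Σ; _×_; _,_; proj₁; proj₂; swap)
open import Data.Sum as Sum using (_⊎_; inj₁; inj₂; [_,_]′)
open import Data.Empty using (⊥; ⊥-elim)
open import Function using (_∘_; id; _↔_; Inverse)
open import Function.Definitions using (Injective)
open import Relation.Binary.PropositionalEquality using (_≡_; _≢_; refl; trans; cong; cong₂; subst;
  module ≡-Reasoning; subst₂; ≢-sym) renaming (sym to ≡-sym)
open import Relation.Nullary using (¬_; yes; no; contradiction; Dec; does; ¬?; _×-dec_; _⊎-dec_; _→-dec_)
open import Data.Fin.Patterns using (0F; 1F; 2F; 3F; 4F; 5F; 6F; 7F)
open import Relation.Binary.Construct.Closure.ReflexiveTransitive using (Star; ε; _◅_; _◅◅_; gmap; reverse)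
open import Data.Nat.Tactic.RingSolver using (solve-∀)
open import Data.Fin.Subset using (Subset; _∈_; _∉_; ∣_∣; _-_)
open import Data.Fin.Subset.Properties using (nonempty?; x∈p∧x≢y⇒x∈p-y; x∈p⇒∣p-x∣<∣p∣; p─q⊆p)
open import Data.List using (List; []; _∷_; length; lookup)
open import Data.List.Membership.Propositional using () renaming (_∈_ to _∈ˡ_)
open import Data.List.Membership.Propositional.Properties using (∈-lookup)
open import Data.List.Relation.Unary.Any using (here; there) renaming (any? to anyˡ?)
open import Data.List.Relation.Unary.All using (All; []; _∷_) renaming (lookup to All-lookup;
  tabulate to All-tabulate)
open import Data.List.Relation.Unary.All.Properties using (¬Any⇒All¬)
open import Data.List.Relation.Unary.AllPairs using ([]; _∷_)
open import Data.List.Relation.Unary.Unique.Propositional using (Unique)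
open import Relation.Nullary.Decidable using (dec-true; dec-false; from-yes)
open import Relation.Binary.Definitions using (DecidableEquality)
open import Data.Product.Properties using (≡-dec; ,-injectiveˡ; ,-injectiveʳ)
open import Data.Nat.Divisibility using (_∣_; divides)
open import Data.Sum.Function.Propositional using (_⊎-↔_)
open import Function.Construct.Identity using (↔-id)
open import Function.Construct.Composition using (_↔-∘_)

-- Finite sums, counting, and the cyclic successor

-- The arm lengths are dictated by a double count. Passing through a fragment takes two vertices
-- plus the two arms used, so to reach `2 k + 3 = 15 + 4 t` vertices a pentagon needs `5 + 4 t`
-- units of arm length and a hexagon `3 + 4 t`. A sector has two of each, which makes `16 + 16 t`.
-- Its eight fragments own `1 + t` units each, and every unit borders two faces, which supplies
-- exactly `16 + 16 t`. So no arm may border a cap, and every other face of `H` ends up at exactly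
-- `2 k + 3`. A truncation adds two vertices, so fragments have odd order: this is where `k` even
-- enters.
--
-- Long faces do not suffice, since every cycle has to be long. The edges of `H` are ranked, and a
-- cycle is tested at its crossing edge of least rank, so that all edges of lower rank are absent.
-- This peels `H` apart until most edges lead into a dead end, and few genuine distance computations
-- remain. To settle these for all `t` and all `c` at once, lengths are linear forms in `t` compared
-- coefficientwise, and sectors are recorded only relative to the tested one; what is left is a
-- finite check.

sum : ∀ {n} → (Fin n → ℕ) → ℕ
sum {zero}  f = 0
sum {suc n} f = f zero + sum (f ∘ suc)

-- The summation inside numDarts has no name in scope; the underscore is
-- instantiated to it by numDarts-sum.
mutual
  sumDeg-sum : ∀ G m (d : Fin m → ℕ) → _ ≡ sum d
  sumDeg-sum G zero    d = refl
  sumDeg-sum G (suc m) d = cong (d zero +_) (sumDeg-sum G m (d ∘ suc))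

  numDarts-sum : ∀ G → numDarts G ≡ sum (degree G)
  numDarts-sum G with order G | degree G
  ... | n | d = sumDeg-sum G n d

sum-const : ∀ {n} (f : Fin n → ℕ) c → (∀ v → f v ≡ c) → sum f ≡ n * c
sum-const {zero}  f c h = refl
sum-const {suc n} f c h = cong₂ _+_ (h zero) (sum-const (f ∘ suc) c (h ∘ suc))

sum-cong : ∀ {n} {f g : Fin n → ℕ} → (∀ v → f v ≡ g v) → sum f ≡ sum g
sum-cong {zero}  h = refl
sum-cong {suc n} h = cong₂ _+_ (h zero) (sum-cong (h ∘ suc))

sum-*-distribʳ : ∀ {n} (f : Fin n → ℕ) c → sum (λ v → f v * c) ≡ sum f * c
sum-*-distribʳ {zero}  f c = refl
sum-*-distribʳ {suc n} f c =
  trans (cong (f zero * c +_) (sum-*-distribʳ (f ∘ suc) c)) (≡-sym (*-distribʳ-+ c (f zero) (sum (f ∘ suc))))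

-- Subtraction-free form of changing a single summand: each side carries the value that the other
-- one lacks.
sum-update : ∀ {n} (f g : Fin n → ℕ) v → (∀ u → u ≢ v → f u ≡ g u) → sum f + g v ≡ sum g + f v
sum-update {suc n} f g zero h = begin
  f zero + sum (f ∘ suc) + g zero  ≡⟨ cong (λ z → f zero + z + g zero) (sum-cong λ u → h (suc u) λ ()) ⟩
  f zero + sum (g ∘ suc) + g zero  ≡⟨ +-assoc (f zero) _ _ ⟩
  f zero + (sum (g ∘ suc) + g zero) ≡⟨ +-comm (f zero) _ ⟩
  sum (g ∘ suc) + g zero + f zero  ≡⟨ cong (_+ f zero) (+-comm _ (g zero)) ⟩
  g zero + sum (g ∘ suc) + f zero  ∎
  where open ≡-Reasoning
sum-update {suc n} f g (suc v) h = begin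
  f zero + sum (f ∘ suc) + g (suc v)    ≡⟨ +-assoc (f zero) _ _ ⟩
  f zero + (sum (f ∘ suc) + g (suc v))
      ≡⟨ cong₂ _+_ (h zero λ ())
      (sum-update (f ∘ suc) (g ∘ suc) v λ u u≢v → h (suc u) (u≢v ∘ fsuc-injective)) ⟩
  g zero + (sum (g ∘ suc) + f (suc v))  ≡⟨ +-assoc (g zero) _ _ ⟨
  g zero + sum (g ∘ suc) + f (suc v)    ∎
  where open ≡-Reasoning

sum-positive : ∀ {n} (f : Fin n → ℕ) {b} → sum f ≡ suc b → Σ (Fin n) λ v → Σ ℕ λ m → f v ≡ suc m
sum-positive {suc n} f eq with f zero in e
... | suc m = zero , m , e
... | zero  with v , m , e′ ← sum-positive (f ∘ suc) eq = suc v , m , e′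

sum-zero : ∀ {n} (f : Fin n → ℕ) → sum f ≡ 0 → ∀ v → f v ≡ 0
sum-zero {suc n} f eq zero    = m+n≡0⇒m≡0 (f zero) eq
sum-zero {suc n} f eq (suc v) = sum-zero (f ∘ suc) (m+n≡0⇒n≡0 (f zero) eq) v

count-sum : ∀ {n} (p : Fin n → Bool) → count p ≡ sum (λ v → if p v then 1 else 0)
count-sum {zero}  p = refl
count-sum {suc n} p = cong ((if p zero then 1 else 0) +_) (count-sum (p ∘ suc))

rank : ∀ {n} (p : Fin n → Bool) v → p v ≡ true → Fin (count p)
rank p zero    h with p zero
... | true  = zero
rank p (suc v) h with p zero
... | true  = suc (rank (p ∘ suc) v h)
... | false = rank (p ∘ suc) v h

rank-injective : ∀ {n} (p : Fin n → Bool) v w hv hw → rank p v hv ≡ rank p w hw → v ≡ w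
rank-injective p zero    zero    hv hw eq = refl
rank-injective p zero    (suc w) hv hw eq with p zero
rank-injective p zero    (suc w) hv hw () | true
rank-injective p (suc v) zero    hv hw eq with p zero
rank-injective p (suc v) zero    hv hw () | true
rank-injective p (suc v) (suc w) hv hw eq with p zero
... | true  = cong suc (rank-injective (p ∘ suc) v w hv hw (fsuc-injective eq))
... | false = cong suc (rank-injective (p ∘ suc) v w hv hw eq)

member : ∀ {n} (p : Fin n → Bool) → Fin (count p) → Fin n
member {suc n} p i with p zero
member {suc n} p zero    | true  = zero
member {suc n} p (suc i) | true  = suc (member (p ∘ suc) i)
member {suc n} p i       | false = suc (member (p ∘ suc) i)

member-true : ∀ {n} (p : Fin n → Bool) i → p (member p i) ≡ true
member-true {suc n} p i with p zero in e
member-true {suc n} p zero    | true  = e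
member-true {suc n} p (suc i) | true  = member-true (p ∘ suc) i
member-true {suc n} p i       | false = member-true (p ∘ suc) i

member-injective : ∀ {n} (p : Fin n → Bool) → Injective _≡_ _≡_ (member p)
member-injective {suc n} p {i} {j} eq with p zero
member-injective {suc n} p {zero}  {zero}  eq | true  = refl
member-injective {suc n} p {suc i} {suc j} eq | true  = cong suc
    (member-injective (p ∘ suc) (fsuc-injective eq))
member-injective {suc n} p {i}     {j}     eq | false = member-injective (p ∘ suc) (fsuc-injective eq)

injection⇒≤count : ∀ {m n} (p : Fin n → Bool) (f : Fin m → Fin n) → Injective _≡_ _≡_ f →
                   (∀ i → p (f i) ≡ true) → m ≤ count p
injection⇒≤count p f f-inj h =
  injective⇒≤ {f = λ i → rank p (f i) (h i)} λ {i} {j} eq → f-inj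
      (rank-injective p (f i) (f j) (h i) (h j) eq)

covering⇒count≤ : ∀ {m n} (p : Fin n → Bool) (f : Fin m → Fin n) →
                  (∀ v → p v ≡ true → Σ (Fin m) λ i → f i ≡ v) → count p ≤ m
covering⇒count≤ {m} p f h = injective⇒≤ {f = proj₁ ∘ pre} λ {i} {j} eq →
  member-injective p (trans (≡-sym (proj₂ (pre i))) (trans (cong f eq) (proj₂ (pre j))))
  where
  pre : ∀ i → Σ (Fin m) λ a → f a ≡ member p i
  pre i = h (member p i) (member-true p i)

-- Rotations of a finite cycle

next-inject₁ : ∀ {m} (j : Fin m) → next (inject₁ j) ≡ suc j
next-inject₁ zero    = refl
next-inject₁ (suc j) rewrite next-inject₁ j = refl

next-fromℕ : ∀ m → next (fromℕ m) ≡ zero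
next-fromℕ zero    = refl
next-fromℕ (suc m) rewrite next-fromℕ m = refl

prev : ∀ {m} → Fin (suc m) → Fin (suc m)
prev zero    = fromℕ _
prev (suc j) = inject₁ j

next-prev : ∀ {m} (i : Fin (suc m)) → next (prev i) ≡ i
next-prev zero    = next-fromℕ _
next-prev (suc j) = next-inject₁ j

prev-next : ∀ {m} (i : Fin (suc m)) → prev (next i) ≡ i
prev-next i with view i
... | ‵fromℕ     = cong prev (next-fromℕ _)
... | ‵inject₁ j = cong prev (next-inject₁ j)

next-injective : ∀ {m} {i j : Fin (suc m)} → next i ≡ next j → i ≡ j
next-injective {i = i} {j} eq = trans (≡-sym (prev-next i)) (trans (cong prev eq) (prev-next j))

iterate-+ : ∀ {A : Set} (f : A → A) a b x → iterate f (a + b) x ≡ iterate f a (iterate f b x)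
iterate-+ f zero    b x = refl
iterate-+ f (suc a) b x = cong f (iterate-+ f a b x)

iterate-next : ∀ {m} t (i : Fin (suc m)) → toℕ i ≡ t → iterate next t zero ≡ i
iterate-next         zero    zero    eq = refl
iterate-next {suc m} (suc t) (suc i) eq =
  trans (cong next (iterate-next t (inject₁ i) (trans (toℕ-inject₁ i) (suc-injective eq)))) (next-inject₁ i)

iterate-next-period : ∀ {m} (i : Fin (suc m)) → iterate next (suc m) i ≡ i
iterate-next-period {m} i = begin
  iterate next (suc m) i
      ≡⟨ cong (iterate next (suc m)) (iterate-next _ i refl) ⟨
  iterate next (suc m) (iterate next (toℕ i) zero)      ≡⟨ iterate-+ next (suc m) (toℕ i) zero ⟨
  iterate next (suc m + toℕ i) zero
      ≡⟨ cong (λ z → iterate next z zero) (+-comm (suc m) (toℕ i)) ⟩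
  iterate next (toℕ i + suc m) zero                     ≡⟨ iterate-+ next (toℕ i) (suc m) zero ⟩
  iterate next (toℕ i) (next (iterate next m zero))     ≡⟨ cong (λ z → iterate next (toℕ i) (next z)) last ⟩
  iterate next (toℕ i) (next (fromℕ m))                 ≡⟨ cong (iterate next (toℕ i)) (next-fromℕ m) ⟩
  iterate next (toℕ i) zero                             ≡⟨ iterate-next _ i refl ⟩
  i                                                     ∎
  where
  open ≡-Reasoning
  last : iterate next m zero ≡ fromℕ m
  last = iterate-next m (fromℕ m) (toℕ-fromℕ m)

iterate-next-reaches : ∀ {m} (i j : Fin (suc m)) → Σ ℕ λ k → iterate next k i ≡ j
iterate-next-reaches {m} i j = toℕ j + (suc m ∸ toℕ i) , (begin
  iterate next (toℕ j + (suc m ∸ toℕ i)) i                     ≡⟨ iterate-+ next (toℕ j) (suc m ∸ toℕ i) i ⟩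
  iterate next (toℕ j) (iterate next (suc m ∸ toℕ i) i)        ≡⟨ cong (iterate next (toℕ j)) home ⟩
  iterate next (toℕ j) zero                                    ≡⟨ iterate-next _ j refl ⟩
  j                                                            ∎)
  where
  open ≡-Reasoning
  home : iterate next (suc m ∸ toℕ i) i ≡ zero
  home = begin
    iterate next (suc m ∸ toℕ i) i
        ≡⟨ cong (iterate next (suc m ∸ toℕ i)) (iterate-next _ i refl) ⟨
    iterate next (suc m ∸ toℕ i) (iterate next (toℕ i) zero)
        ≡⟨ iterate-+ next (suc m ∸ toℕ i) (toℕ i) zero ⟨
    iterate next (suc m ∸ toℕ i + toℕ i) zero
        ≡⟨ cong (λ k → iterate next k zero) (m∸n+n≡m (<⇒≤ (toℕ<n i))) ⟩
    iterate next (suc m) zero                                   ≡⟨ iterate-next-period zero ⟩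
    zero                                                        ∎

iterate-next-injective : ∀ {m} k {i j : Fin (suc m)} → iterate next k i ≡ iterate next k j → i ≡ j
iterate-next-injective zero    eq = eq
iterate-next-injective (suc k) eq = iterate-next-injective k (next-injective eq)

-- Rotations commute and are injective, so a fixed point at `i` yields one at `zero`; but `suc k`
-- steps from `zero` end at index `suc k`.
next-aperiodic : ∀ {m} k → suc k < suc m → (i : Fin (suc m)) → iterate next (suc k) i ≢ i
next-aperiodic {m} k k<m i eq = contradiction (cong toℕ moved)
    (λ e → 0≢1+n (trans (≡-sym e) (toℕ-fromℕ< k<m)))
  where
  open ≡-Reasoning
  moved : fromℕ< k<m ≡ zero
  moved = iterate-next-injective (toℕ i) (begin
    iterate next (toℕ i) (fromℕ< k<m)
        ≡⟨ cong (iterate next (toℕ i)) (iterate-next (suc k) (fromℕ< k<m) (toℕ-fromℕ< k<m)) ⟨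
    iterate next (toℕ i) (iterate next (suc k) zero) ≡⟨ iterate-+ next (toℕ i) (suc k) zero ⟨
    iterate next (toℕ i + suc k) zero
        ≡⟨ cong (λ t → iterate next t zero) (+-comm (toℕ i) (suc k)) ⟩
    iterate next (suc k + toℕ i) zero                ≡⟨ iterate-+ next (suc k) (toℕ i) zero ⟩
    iterate next (suc k) (iterate next (toℕ i) zero) ≡⟨ cong (iterate next (suc k)) (iterate-next _ i refl) ⟩
    iterate next (suc k) i                           ≡⟨ eq ⟩
    i                                                ≡⟨ iterate-next _ i refl ⟨
    iterate next (toℕ i) zero                        ∎)

next≢ : ∀ {m} (i : Fin (2 + m)) → next i ≢ i
next≢ = next-aperiodic 0 (s≤s (s≤s z≤n))

next²≢ : ∀ {m} (i : Fin (3 + m)) → next (next i) ≢ i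
next²≢ = next-aperiodic 1 (s≤s (s≤s (s≤s z≤n)))

≡prev⇒next≡ : ∀ {m} {i j : Fin (suc m)} → j ≡ prev i → next j ≡ i
≡prev⇒next≡ {i = i} refl = next-prev i

prev≢ : ∀ {m} (i : Fin (2 + m)) → prev i ≢ i
prev≢ i eq = next≢ i (≡prev⇒next≡ (≡-sym eq))

next≢prev : ∀ {m} (i : Fin (3 + m)) → next i ≢ prev i
next≢prev i eq = next²≢ i (≡prev⇒next≡ eq)

-- Cubic maps and truncation

Dart : Set → Set
Dart V = V × Fin 3

turn : ∀ {V} → Dart V → Dart V
turn (v , i) = v , next i

-- A simple cubic graph with a rotation system: the darts at v are (v , 0),
-- (v , 1), (v , 2) in cyclic order and α reverses darts.
record CubicMap (V : Set) : Set where
  field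
    α          : Dart V → Dart V
    involutive : ∀ d → α (α d) ≡ d
    loopless   : ∀ d → proj₁ (α d) ≢ proj₁ d
    simple     : ∀ d e → proj₁ d ≡ proj₁ e → proj₁ (α d) ≡ proj₁ (α e) → d ≡ e

  step : Dart V → Dart V
  step d = turn (α d)

  _⟶_ : Dart V → Dart V → Set
  d ⟶ e = step d ≡ e

open CubicMap

Avoids : {V : Set} → V → V → V → Set
Avoids a b u = u ≢ a × u ≢ b

data Link {V : Set} (M : CubicMap V) (a b : V) : V → V → Set where
  link : ∀ d → Avoids a b (proj₁ d) → Avoids a b (proj₁ (α M d)) → Link M a b (proj₁ d) (proj₁ (α M d))

Link-sym : ∀ {V} (M : CubicMap V) {a b u w} → Link M a b u w → Link M a b w u
Link-sym M (link d p q) = subst (λ e → Link M _ _ (proj₁ (α M d)) (proj₁ e)) (involutive M d)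
  (link (α M d) q (subst (Avoids _ _ ∘ proj₁) (≡-sym (involutive M d)) p))

Link-swap : ∀ {V} (M : CubicMap V) {a b u w} → Link M a b u w → Link M b a u w
Link-swap M (link d (p , p′) (q , q′)) = link d (p′ , p) (q′ , q)

Connected₃ : {V : Set} → CubicMap V → Set
Connected₃ {V} M = ∀ a b u w → Avoids a b u → Avoids a b w → Star (Link M a b) u w

record Faces {V : Set} (M : CubicMap V) (L : Set) : Set where
  field
    face      : Dart V → L
    face-step : ∀ d → face (step M d) ≡ face d
    face-orbit : ∀ d e → face d ≡ face e → Star (_⟶_ M) d e
    onFace    : L → Dart V
    face-onFace : ∀ l → face (onFace l) ≡ l

-- Truncating v turns it into a triangle. The corner on dart i of v is
-- corner i, where corner 0 keeps the name of v; dart 0 of a corner points out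
-- of the triangle and its darts 1 (fwd) and 2 (bwd) run along it.
module Truncation {n} (M : CubicMap (Fin n)) (v : Fin n) where

  V′ : Set
  V′ = Fin (suc (suc n))

  old : Fin n → V′
  old u = suc (suc u)

  corner : Fin 3 → V′
  corner 0F = old v
  corner 1F = zero
  corner 2F = suc zero

  -- Darts of the truncated map sorted by origin. `emb` and `kind` are mutually inverse, so the
  -- axioms of a cubic map reduce to a case split on `Kind`.
  data Kind : Set where
    lifted  : Dart (Fin n) → Kind
    fwd bwd : Fin 3 → Kind

  emb : Kind → Dart V′
  emb (lifted (u , i)) with u ≟ v
  ... | yes _ = corner i , 0F
  ... | no  _ = old u , i
  emb (fwd i) = corner i , 1F
  emb (bwd i) = corner i , 2F

  emb-v : ∀ i → emb (lifted (v , i)) ≡ (corner i , 0F)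
  emb-v i with v ≟ v
  ... | yes _   = refl
  ... | no  v≢v = contradiction refl v≢v

  emb-old : ∀ u i → u ≢ v → emb (lifted (u , i)) ≡ (old u , i)
  emb-old u i u≢v with u ≟ v
  ... | yes u≡v = contradiction u≡v u≢v
  ... | no  _   = refl

  cornerKind : Fin 3 → Fin 3 → Kind
  cornerKind j 0F = lifted (v , j)
  cornerKind j 1F = fwd j
  cornerKind j 2F = bwd j

  kind : Dart V′ → Kind
  kind (zero        , i) = cornerKind 1F i
  kind (suc zero    , i) = cornerKind 2F i
  kind (suc (suc u) , i) with u ≟ v
  ... | yes _ = cornerKind 0F i
  ... | no  _ = lifted (u , i)

  emb-cornerKind : ∀ j i → emb (cornerKind j i) ≡ (corner j , i)
  emb-cornerKind j 0F = emb-v j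
  emb-cornerKind j 1F = refl
  emb-cornerKind j 2F = refl

  emb-kind : ∀ d → emb (kind d) ≡ d
  emb-kind (zero        , i) = emb-cornerKind 1F i
  emb-kind (suc zero    , i) = emb-cornerKind 2F i
  emb-kind (suc (suc u) , i) with u ≟ v
  ... | yes refl = emb-cornerKind 0F i
  ... | no  u≢v  = emb-old u i u≢v

  kind-corner : ∀ j i → kind (corner j , i) ≡ cornerKind j i
  kind-corner 1F i = refl
  kind-corner 2F i = refl
  kind-corner 0F i with v ≟ v
  ... | yes _   = refl
  ... | no  v≢v = contradiction refl v≢v

  kind-emb : ∀ k → kind (emb k) ≡ k
  kind-emb (fwd j) = kind-corner j 1F
  kind-emb (bwd j) = kind-corner j 2F
  kind-emb (lifted (u , i)) with u ≟ v
  ... | yes refl = kind-corner i 0F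
  ... | no  u≢v  with u ≟ v
  ...   | yes u≡v = contradiction u≡v u≢v
  ...   | no  _   = refl

  emb-elim : (P : Dart V′ → Set) → (∀ k → P (emb k)) → ∀ d → P d
  emb-elim P h d = subst P (emb-kind d) (h (kind d))

  π : V′ → Fin n
  π zero          = v
  π (suc zero)    = v
  π (suc (suc u)) = u

  π-corner : ∀ i → π (corner i) ≡ v
  π-corner 0F = refl
  π-corner 1F = refl
  π-corner 2F = refl

  π-lifted : ∀ d → π (proj₁ (emb (lifted d))) ≡ proj₁ d
  π-lifted (u , i) with u ≟ v
  ... | yes refl = π-corner i
  ... | no  _    = refl

  corner-injective : ∀ {i j} → corner i ≡ corner j → i ≡ j
  corner-injective {0F} {0F} eq = refl
  corner-injective {1F} {1F} eq = refl
  corner-injective {2F} {2F} eq = refl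
  corner-injective {0F} {1F} ()
  corner-injective {0F} {2F} ()
  corner-injective {1F} {2F} ()

  αᴷ : Kind → Kind
  αᴷ (lifted d) = lifted (α M d)
  αᴷ (fwd i)    = bwd (next i)
  αᴷ (bwd i)    = fwd (prev i)

  αᴷ-involutive : ∀ k → αᴷ (αᴷ k) ≡ k
  αᴷ-involutive (lifted d) = cong lifted (involutive M d)
  αᴷ-involutive (fwd i)    = cong fwd (prev-next i)
  αᴷ-involutive (bwd i)    = cong bwd (next-prev i)

  α′ : Dart V′ → Dart V′
  α′ d = emb (αᴷ (kind d))

  α′-emb : ∀ k → α′ (emb k) ≡ emb (αᴷ k)
  α′-emb k = cong (emb ∘ αᴷ) (kind-emb k)

  loopless-emb : ∀ k → proj₁ (emb (αᴷ k)) ≢ proj₁ (emb k)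
  loopless-emb (lifted d) eq = loopless M d
      (trans (≡-sym (π-lifted (α M d))) (trans (cong π eq) (π-lifted d)))
  loopless-emb (fwd i) eq = next≢ i (corner-injective eq)
  loopless-emb (bwd i) eq = prev≢ i (corner-injective eq)

  -- A lifted dart between two corners would be a loop of M.
  lifted-corner : ∀ d i j → proj₁ (emb (lifted d)) ≡ corner i → proj₁ (emb (lifted (α M d))) ≡ corner j → ⊥
  lifted-corner d i j p q = loopless M d (trans (at (α M d) j q) (≡-sym (at d i p)))
    where
    at : ∀ e l → proj₁ (emb (lifted e)) ≡ corner l → proj₁ e ≡ v
    at e l r = trans (≡-sym (π-lifted e)) (trans (cong π r) (π-corner l))

  -- Parallel lifted darts project to parallel darts of `M`, triangle edges are told apart by their
  -- corners, and a lifted dart parallel to a triangle edge would project to a loop.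
  simple-emb : ∀ k l → proj₁ (emb k) ≡ proj₁ (emb l) → proj₁ (emb (αᴷ k)) ≡ proj₁ (emb (αᴷ l)) → k ≡ l
  simple-emb (lifted d) (lifted e) p q = cong lifted (simple M d e (down d e p) (down (α M d) (α M e) q))
    where
    down : ∀ d e → proj₁ (emb (lifted d)) ≡ proj₁ (emb (lifted e)) → proj₁ d ≡ proj₁ e
    down d e r = trans (≡-sym (π-lifted d)) (trans (cong π r) (π-lifted e))
  simple-emb (lifted d) (fwd i) p q = ⊥-elim (lifted-corner d i (next i) p q)
  simple-emb (lifted d) (bwd i) p q = ⊥-elim (lifted-corner d i (prev i) p q)
  simple-emb (fwd i) (lifted e) p q = ⊥-elim (lifted-corner e i (next i) (≡-sym p) (≡-sym q))
  simple-emb (bwd i) (lifted e) p q = ⊥-elim (lifted-corner e i (prev i) (≡-sym p) (≡-sym q))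
  simple-emb (fwd i) (fwd j) p q = cong fwd (corner-injective p)
  simple-emb (bwd i) (bwd j) p q = cong bwd (corner-injective p)
  simple-emb (fwd i) (bwd j) p q = ⊥-elim
      (next≢prev i (trans (corner-injective q) (cong prev (corner-injective (≡-sym p)))))
  simple-emb (bwd i) (fwd j) p q = ⊥-elim
      (next≢prev j (trans (corner-injective (≡-sym q)) (cong prev (corner-injective p))))

  M′ : CubicMap V′
  M′ = record
    { α          = α′
    ; involutive = λ d → trans (α′-emb (αᴷ (kind d))) (trans (cong emb (αᴷ-involutive (kind d))) (emb-kind d))
    ; loopless   = emb-elim _ λ k → subst (λ e → proj₁ e ≢ proj₁ (emb k)) (≡-sym (α′-emb k)) (loopless-emb k)
    ; simple     = emb-elim _ λ k → emb-elim _ λ l p q → cong emb (simple-emb k l p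
        (subst₂ (λ x y → proj₁ x ≡ proj₁ y) (α′-emb k) (α′-emb l) q))
    }

  -- A face that turned at `v` now enters at corner `i`, runs along `fwd i` and leaves at corner
  -- `next i`, so it gains one edge.
  step-v : ∀ d i → α M d ≡ (v , i) → step M′ (emb (lifted d)) ≡ emb (fwd i)
  step-v d i eq = trans (cong turn (α′-emb (lifted d))) (cong turn (trans (cong (emb ∘ lifted) eq) (emb-v i)))

  step-old : ∀ d → proj₁ (α M d) ≢ v → step M′ (emb (lifted d)) ≡ emb (lifted (step M d))
  step-old d ≢v = trans (cong turn (α′-emb (lifted d)))
    (trans (cong turn (emb-old _ _ ≢v)) (≡-sym (emb-old _ _ ≢v)))

  step-fwd : ∀ i → step M′ (emb (fwd i)) ≡ emb (lifted (v , next i))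
  step-fwd i = trans (cong turn (α′-emb (fwd i))) (≡-sym (emb-v (next i)))

  step-bwd : ∀ i → step M′ (emb (bwd i)) ≡ emb (bwd (prev i))
  step-bwd i = cong turn (α′-emb (bwd i))

  Reach′ : Dart V′ → Dart V′ → Set
  Reach′ = Star (_⟶_ M′)

  fwd⟶ : ∀ i → Reach′ (emb (fwd i)) (emb (lifted (v , next i)))
  fwd⟶ i = step-fwd i ◅ ε

  lifted⟶ : ∀ d → Reach′ (emb (lifted d)) (emb (lifted (step M d)))
  lifted⟶ d = go (proj₁ (α M d) ≟ v)
    where
    j = proj₂ (α M d)
    go : Dec (proj₁ (α M d) ≡ v) → Reach′ (emb (lifted d)) (emb (lifted (step M d)))
    go (no  ≢v) = step-old d ≢v ◅ ε
    go (yes eq) = step-v d j (cong (_, j) eq) ◅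
      subst (λ u → Reach′ (emb (fwd j)) (emb (lifted (u , next j)))) (≡-sym eq) (fwd⟶ j)

  lift⟶* : ∀ {d e} → Star (_⟶_ M) d e → Reach′ (emb (lifted d)) (emb (lifted e))
  lift⟶* ε          = ε
  lift⟶* (_◅_ {d} refl r) = lifted⟶ d ◅◅ lift⟶* r

  -- Faces of a truncated map

  module _ {F} (φ : Faces M (Fin F)) where
    open Faces φ

    -- The old faces persist with the `fwd` darts inserted; the `bwd` darts bound the triangle,
    -- which is the one new face.
    faceᴷ : Kind → Fin (suc F)
    faceᴷ (lifted d) = suc (face d)
    faceᴷ (fwd i)    = suc (face (v , next i))
    faceᴷ (bwd i)    = zero

    face-v : ∀ i → face (α M (v , i)) ≡ face (v , next i)
    face-v i = trans (≡-sym (face-step (α M (v , i)))) (cong (face ∘ turn) (involutive M (v , i)))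

    face′ : Dart V′ → Fin (suc F)
    face′ = faceᴷ ∘ kind

    face′-emb : ∀ k → face′ (emb k) ≡ faceᴷ k
    face′-emb k = cong faceᴷ (kind-emb k)

    via : ∀ {e} k {l} → e ≡ emb k → faceᴷ k ≡ l → face′ e ≡ l
    via k p q = trans (cong face′ p) (trans (face′-emb k) q)

    face′-step : ∀ k → face′ (step M′ (emb k)) ≡ faceᴷ k
    face′-step (fwd i) = via (lifted (v , next i)) (step-fwd i) refl
    face′-step (bwd i) = via (bwd (prev i)) (step-bwd i) refl
    face′-step (lifted d) = go (proj₁ (α M d) ≟ v)
      where
      j = proj₂ (α M d)
      go : Dec (proj₁ (α M d) ≡ v) → face′ (step M′ (emb (lifted d))) ≡ suc (face d)
      go (no  ≢v) = via (lifted (step M d)) (step-old d ≢v) (cong suc (face-step d))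
      go (yes eq) = via (fwd j) (step-v d j (cong (_, j) eq))
        (cong suc (trans (cong (λ u → face (u , next j)) (≡-sym eq)) (face-step d)))

    bwd-orbit : ∀ i j → Reach′ (emb (bwd i)) (emb (bwd j))
    bwd-orbit 0F 0F = ε
    bwd-orbit 1F 1F = ε
    bwd-orbit 2F 2F = ε
    bwd-orbit 0F 2F = step-bwd 0F ◅ ε
    bwd-orbit 2F 1F = step-bwd 2F ◅ ε
    bwd-orbit 1F 0F = step-bwd 1F ◅ ε
    bwd-orbit 0F 1F = step-bwd 0F ◅ step-bwd 2F ◅ ε
    bwd-orbit 2F 0F = step-bwd 2F ◅ step-bwd 1F ◅ ε
    bwd-orbit 1F 2F = step-bwd 1F ◅ step-bwd 0F ◅ ε

    ⟶fwd : ∀ d i → face d ≡ face (v , next i) → Reach′ (emb (lifted d)) (emb (fwd i))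
    ⟶fwd d i eq = lift⟶* (face-orbit d (α M (v , i)) (trans eq (≡-sym (face-v i)))) ◅◅
        (step-v _ i (involutive M (v , i)) ◅ ε)

    orbitᴷ : ∀ k l → faceᴷ k ≡ faceᴷ l → Reach′ (emb k) (emb l)
    orbitᴷ (lifted d) (lifted e) eq = lift⟶* (face-orbit d e (fsuc-injective eq))
    orbitᴷ (lifted d) (fwd i)    eq = ⟶fwd d i (fsuc-injective eq)
    orbitᴷ (fwd i)    (lifted e) eq = fwd⟶ i ◅◅ lift⟶* (face-orbit (v , next i) e (fsuc-injective eq))
    orbitᴷ (fwd i)    (fwd j)    eq = fwd⟶ i ◅◅ ⟶fwd (v , next i) j (fsuc-injective eq)
    orbitᴷ (bwd i)    (bwd j)    eq = bwd-orbit i j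

    faces′ : Faces M′ (Fin (suc F))
    faces′ = record
      { face        = face′
      ; face-step   = emb-elim _ λ k → trans (face′-step k) (≡-sym (face′-emb k))
      ; face-orbit  = emb-elim _ λ k → emb-elim _ λ l eq → orbitᴷ k l
          (trans (≡-sym (face′-emb k)) (trans eq (face′-emb l)))
      ; onFace      = λ { zero → emb (bwd 0F) ; (suc l) → emb (lifted (onFace l)) }
      ; face-onFace = λ { zero → face′-emb (bwd 0F) ; (suc l) → trans (face′-emb (lifted (onFace l)))
          (cong suc (face-onFace l)) }
      }

  -- Connectivity of a truncated map

  data Place : V′ → Set where
    at-corner : ∀ i → Place (corner i)
    outside   : ∀ u → u ≢ v → Place (old u)

  place : ∀ x → Place x
  place zero          = at-corner 1F
  place (suc zero)    = at-corner 2F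
  place (suc (suc u)) with u ≟ v
  ... | yes refl = at-corner 0F
  ... | no  u≢v  = outside u u≢v

  link-emb : ∀ {a b} k → Avoids a b (proj₁ (emb k)) → Avoids a b (proj₁ (emb (αᴷ k))) →
             Link M′ a b (proj₁ (emb k)) (proj₁ (emb (αᴷ k)))
  link-emb {a} {b} k p q = subst (λ e → Link M′ a b (proj₁ (emb k)) (proj₁ e)) (α′-emb k)
    (link (emb k) p (subst (Avoids a b ∘ proj₁) (≡-sym (α′-emb k)) q))

  cyclic₃ : ∀ (i j : Fin 3) → i ≡ j ⊎ next i ≡ j ⊎ prev i ≡ j
  cyclic₃ 0F 0F = inj₁ refl
  cyclic₃ 1F 1F = inj₁ refl
  cyclic₃ 2F 2F = inj₁ refl
  cyclic₃ 0F 1F = inj₂ (inj₁ refl)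
  cyclic₃ 1F 2F = inj₂ (inj₁ refl)
  cyclic₃ 2F 0F = inj₂ (inj₁ refl)
  cyclic₃ 0F 2F = inj₂ (inj₂ refl)
  cyclic₃ 1F 0F = inj₂ (inj₂ refl)
  cyclic₃ 2F 1F = inj₂ (inj₂ refl)

  third : ∀ (i j : Fin 3) → j ≢ i → Σ (Fin 3) λ l → l ≢ i × l ≢ j
  third i j j≢i with cyclic₃ i j
  ... | inj₁ refl        = contradiction refl j≢i
  ... | inj₂ (inj₁ refl) = prev i , prev≢ i , ≢-sym (next≢prev i)
  ... | inj₂ (inj₂ refl) = next i , next≢ i , next≢prev i

  corner-walk : ∀ {a b} i j → Avoids a b (corner i) → Avoids a b (corner j) → Star (Link M′ a b) (corner i)
      (corner j)
  corner-walk i j p q with cyclic₃ i j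
  ... | inj₁ refl        = ε
  ... | inj₂ (inj₁ refl) = link-emb (fwd i) p q ◅ ε
  ... | inj₂ (inj₂ refl) = link-emb (bwd i) p q ◅ ε

  module _ {a b} (a≢v : a ≢ v) (b≢v : b ≢ v) where

    lift-avoids : ∀ {x} → Avoids a b (π x) → Avoids (old a) (old b) x
    lift-avoids (p , q) = p ∘ cong π , q ∘ cong π

    fibre-walk : ∀ x y → π x ≡ π y → Avoids (old a) (old b) x → Avoids (old a) (old b) y →
                 Star (Link M′ (old a) (old b)) x y
    fibre-walk x y eq p q with place x | place y
    ... | at-corner i   | at-corner j   = corner-walk i j p q
    ... | outside u u≢v | outside w w≢v rewrite eq = ε
    ... | at-corner i   | outside w w≢v = contradiction (trans (≡-sym eq) (π-corner i)) w≢v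
    ... | outside u u≢v | at-corner j   = contradiction (trans eq (π-corner j)) u≢v

    -- A link of `M` lifts to the edge between two fibres. Within the fibre of `v` the walk moves
    -- freely, because no corner is removed here.
    lift-walk : ∀ {u w} → Star (Link M a b) u w → ∀ x y → π x ≡ u → π y ≡ w →
                Avoids (old a) (old b) x → Avoids (old a) (old b) y → Star (Link M′ (old a) (old b)) x y
    lift-walk ε x y eq eq′ p q = fibre-walk x y (trans eq (≡-sym eq′)) p q
    lift-walk (link d du dw ◅ r) x y eq eq′ p q =
      fibre-walk x s (trans eq (≡-sym (π-lifted d))) p s-ok ◅◅
      (link-emb (lifted d) s-ok t-ok ◅ lift-walk r t y (π-lifted (α M d)) eq′ t-ok q)
      where
      s = proj₁ (emb (lifted d))
      t = proj₁ (emb (lifted (α M d)))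
      s-ok = lift-avoids {s} (subst (Avoids a b) (≡-sym (π-lifted d)) du)
      t-ok = lift-avoids {t} (subst (Avoids a b) (≡-sym (π-lifted (α M d))) dw)

  module _ (conn : Connected₃ M) where

    -- When a corner is removed, everything left hangs on M minus v and the
    -- projection of the other removed vertex.
    module CornerRemoved (i : Fin 3) (b : V′) where

      W : V′ → V′ → Set
      W = Star (Link M′ (corner i) b)

      old-avoids : ∀ {x} → Avoids v (π b) x → Avoids (corner i) b (old x)
      old-avoids (p , q) = (λ eq → p (trans (cong π eq) (π-corner i))) , q ∘ cong π

      lifted-link : ∀ d → Avoids v (π b) (proj₁ d) → Avoids v (π b) (proj₁ (α M d)) →
                    Link M′ (corner i) b (old (proj₁ d)) (old (proj₁ (α M d)))
      lifted-link d p q = subst₂ (Link M′ (corner i) b) (at d (proj₁ p)) (at (α M d) (proj₁ q))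
        (link-emb (lifted d)
          (subst (Avoids (corner i) b) (≡-sym (at d (proj₁ p))) (old-avoids p))
          (subst (Avoids (corner i) b) (≡-sym (at (α M d) (proj₁ q))) (old-avoids q)))
        where
        at : ∀ e → proj₁ e ≢ v → proj₁ (emb (lifted e)) ≡ old (proj₁ e)
        at (u , j) u≢v = cong proj₁ (emb-old u j u≢v)

      old-walk : ∀ {u w} → Star (Link M v (π b)) u w → W (old u) (old w)
      old-walk = gmap old λ { (link d p q) → lifted-link d p q }

      exit : ∀ j → Avoids (corner i) b (corner j) → proj₁ (α M (v , j)) ≢ π b →
             Σ (Fin n) λ x → Avoids v (π b) x × W (corner j) (old x)
      exit j ok ≢b = x , (x≢v , ≢b) , subst₂ (Link M′ (corner i) b) p q
          (link-emb (lifted (v , j)) (subst (Avoids _ b) (≡-sym p) ok)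
              (subst (Avoids _ b) (≡-sym q) (old-avoids (x≢v , ≢b)))) ◅ ε
        where
        x = proj₁ (α M (v , j))
        x≢v : x ≢ v
        x≢v = loopless M (v , j)
        p : proj₁ (emb (lifted (v , j))) ≡ corner j
        p = cong proj₁ (emb-v j)
        q : proj₁ (emb (lifted (α M (v , j)))) ≡ old x
        q = cong proj₁ (emb-old x (proj₂ (α M (v , j))) x≢v)

      -- A corner is left through its outward edge. If that edge ends in the removed vertex `b`, the
      -- other surviving corner serves instead: its outward edge ends elsewhere, as `M` has no
      -- parallel edges.
      escape : ∀ x → Avoids (corner i) b x → Σ (Fin n) λ y → Avoids v (π b) y × W x (old y)
      escape x ok with place x | place b
      ... | outside u u≢v | at-corner l   = u , (u≢v , λ eq → u≢v (trans eq (π-corner l))) , ε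
      ... | outside u u≢v | outside w w≢v = u , (u≢v , λ eq → proj₂ ok (cong old eq)) , ε
      ... | at-corner j   | at-corner l   = exit j ok (λ eq → loopless M (v , j) (trans eq (π-corner l)))
      ... | at-corner j   | outside w w≢v with proj₁ (α M (v , j)) ≟ w
      ...   | no  ≢w = exit j ok ≢w
      ...   | yes ≡w with l , l≢i , l≢j ← third i j (proj₁ ok ∘ cong corner) =
        let l-ok = l≢i ∘ corner-injective , λ eq → w≢v (trans (≡-sym (cong π eq)) (π-corner l))
            y , y-ok , r = exit l l-ok λ eq → l≢j
                (cong proj₂ (simple M (v , l) (v , j) refl (trans eq (≡-sym ≡w))))
        in y , y-ok , corner-walk j l ok l-ok ◅◅ r

      walk : ∀ x y → Avoids (corner i) b x → Avoids (corner i) b y → W x y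
      walk x y p q =
        let x₀ , x₀-ok , r = escape x p
            y₀ , y₀-ok , s = escape y q
        in r ◅◅ (old-walk (conn v (π b) x₀ y₀ x₀-ok y₀-ok) ◅◅ reverse (Link-sym M′) s)

    connected₃′ : Connected₃ M′
    connected₃′ a b x y p q with place a | place b
    ... | at-corner i   | _             = CornerRemoved.walk i b x y p q
    ... | outside u u≢v | at-corner j   = gmap id (Link-swap M′)
        (CornerRemoved.walk j (old u) x y (swap p) (swap q))
    ... | outside u u≢v | outside w w≢v = lift-walk u≢v w≢v
        (conn u w (π x) (π y) (down p) (down q)) x y refl refl p q
      where
      down : ∀ {z} → Avoids (old u) (old w) z → Avoids u w (π z)
      down {z} (p , q) with place z
      ... | at-corner i   = (λ eq → u≢v (trans (≡-sym eq) (π-corner i))) , λ eq → w≢v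
          (trans (≡-sym eq) (π-corner i))
      ... | outside t t≢v = p ∘ cong old , q ∘ cong old

-- Iterated truncation and extension of potentials

-- How a vertex is still to be truncated. A fresh vertex becomes a triangle
-- whose corner on dart i becomes an arm of length γ i, and an arm of length
-- r + 1 becomes a triangle whose corner on dart 0 is an arm of length r.
data Site : Set where
  fresh : (Fin 3 → ℕ) → Site
  arm   : ℕ → Site

core : Site → ℕ
core (fresh γ) = 1
core (arm r)   = 0

leg : Site → Fin 3 → ℕ
leg (fresh γ) i       = γ i
leg (arm r)   zero    = r
leg (arm r)   (suc _) = 0

total : (Fin 3 → ℕ) → ℕ
total ρ = ρ 0F + (ρ 1F + ρ 2F)

budget : Site → ℕ
budget σ = core σ + total (leg σ)

-- Distance between the ends on darts i and j of the fragment that finally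
-- replaces the vertex.
slack : Site → Fin 3 → Fin 3 → ℕ
slack σ i j = core σ + (leg σ i + leg σ j)

shrink : Site → Fin 3 → ℕ
shrink (fresh γ) = γ
shrink (arm r)   = leg (arm (pred r))

budget-shrink : ∀ σ {m} → budget σ ≡ suc m → budget σ ≡ suc (total (shrink σ))
budget-shrink (fresh γ)     eq = refl
budget-shrink (arm (suc r)) eq = refl

-- Equality holds except between the two side darts of an arm: these are held at equal potential,
-- although their ends finally lie one edge apart.
slack-shrink : ∀ σ {m} → budget σ ≡ suc m → ∀ i j → i ≢ j → slack σ i j ≤ suc (shrink σ i + shrink σ j)
slack-shrink (fresh γ)     eq i       j       i≢j = ≤-refl
slack-shrink (arm (suc r)) eq zero    zero    i≢j = contradiction refl i≢j
slack-shrink (arm (suc r)) eq zero    (suc j) i≢j = ≤-refl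
slack-shrink (arm (suc r)) eq (suc i) zero    i≢j = ≤-refl
slack-shrink (arm (suc r)) eq (suc i) (suc j) i≢j = z≤n

-- One-dimensional Helly: the intervals [x i − ρ i , x i + ρ i] are pairwise
-- at distance at most 1, so moving each towards the largest left end works.
module Interpolation (x ρ : Fin 3 → ℕ) (near : ∀ i j → i ≢ j → x i ≤ x j + suc (ρ i + ρ j)) where

  top : ℕ
  top = (x 0F ∸ ρ 0F) ⊔ ((x 1F ∸ ρ 1F) ⊔ (x 2F ∸ ρ 2F))

  mid : Fin 3 → ℕ
  mid i = (x i + ρ i) ⊓ top

  below-top : ∀ i → x i ∸ ρ i ≤ top
  below-top 0F = m≤m⊔n _ _
  below-top 1F = ≤-trans (m≤m⊔n _ _) (m≤n⊔m (x 0F ∸ ρ 0F) _)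
  below-top 2F = ≤-trans (m≤n⊔m (x 1F ∸ ρ 1F) _) (m≤n⊔m (x 0F ∸ ρ 0F) _)

  mid≤ : ∀ i → mid i ≤ x i + ρ i
  mid≤ i = m⊓n≤m _ _

  ≤mid : ∀ i → x i ≤ mid i + ρ i
  ≤mid i = begin
    x i                    ≤⟨ m≤n+m∸n (x i) (ρ i) ⟩
    ρ i + (x i ∸ ρ i)
        ≤⟨ +-monoʳ-≤ (ρ i) (⊓-glb (≤-trans (m∸n≤m (x i) (ρ i)) (m≤m+n _ _)) (below-top i)) ⟩
    ρ i + mid i            ≡⟨ +-comm (ρ i) (mid i) ⟩
    mid i + ρ i            ∎
    where open ≤-Reasoning

  left-end : ∀ i j → x i ∸ ρ i ≤ suc (x j + ρ j)
  left-end i j with i ≟ j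
  ... | yes refl = ≤-trans (m∸n≤m (x i) (ρ i)) (≤-trans (m≤m+n _ _) (n≤1+n _))
  ... | no  i≢j  = m≤n+o⇒m∸n≤o (x i) (ρ i) (≤-trans (near i j i≢j) (≤-reflexive (eq (x j) (ρ i) (ρ j))))
    where
    eq : ∀ a b c → a + suc (b + c) ≡ b + suc (a + c)
    eq = solve-∀

  mid-near : ∀ i j → mid i ≤ suc (mid j)
  mid-near i j = ≤-trans (m⊓n≤n (x i + ρ i) top)
    (⊓-glb (⊔-lub (left-end 0F j) (⊔-lub (left-end 1F j) (left-end 2F j))) (n≤1+n top))

module _ {B : Set} (H : CubicMap B) (γ : B → Fin 3 → ℕ) where

  -- The allowance is the slack of the site `fresh (γ h)`, that is, the length of a passage through
  -- the finished fragment of `h`.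
  Tame : (Dart B → ℕ) → Set
  Tame x = ∀ h i j → x (h , i) ≤ x (h , j) + suc (γ h i + γ h j)

  -- A partially truncated copy of H. Vertices stemming from the vertex h of H
  -- have colour h, ι embeds the darts of H, and K c is the number of vertices
  -- of the fully truncated map when those of colour h count c h times.
  record Expansion (K : (B → ℕ) → ℕ) (n : ℕ) : Set where
    field
      M        : CubicMap (Fin n)
      site     : Fin n → Site
      colour   : Fin n → B
      ι        : Dart B → Dart (Fin n)
      ι-α      : ∀ d → α M (ι d) ≡ ι (α H d)
      colour-ι : ∀ d → colour (proj₁ (ι d)) ≡ proj₁ d
      crossing : ∀ d → (Σ (Dart B) λ e → d ≡ ι e) ⊎ colour (proj₁ d) ≡ colour (proj₁ (α M d))
      extend   : ∀ x → Tame x → Σ (Dart (Fin n) → ℕ) λ y → (∀ d → y (ι d) ≡ x d) ×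
                   (∀ v i j → y (v , i) ≤ y (v , j) + slack (site v) i j) ×
                   (∀ d → colour (proj₁ d) ≡ colour (proj₁ (α M d)) → y d ≤ suc (y (α M d)))
      mass     : ∀ c → sum (λ v → c (colour v) * suc (2 * budget (site v))) ≡ K c
      {F}      : ℕ
      faces    : Faces M (Fin F)
      euler    : 2 * F ≡ n + 4
      connected : Connected₃ M

  module _ {K n} (X : Expansion K n) where
    open Expansion X

    module Shrink (v : Fin n) {m} (positive : budget (site v) ≡ suc m) where
      open Truncation M v

      ρ : Fin 3 → ℕ
      ρ = shrink (site v)

      siteAt : ∀ u → Dec (u ≡ v) → Site
      siteAt u (yes _) = arm (ρ 0F)
      siteAt u (no  _) = site u

      site′ : V′ → Site
      site′ zero          = arm (ρ 1F)
      site′ (suc zero)    = arm (ρ 2F)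
      site′ (suc (suc u)) = siteAt u (u ≟ v)

      site′-corner : ∀ i → site′ (corner i) ≡ arm (ρ i)
      site′-corner 1F = refl
      site′-corner 2F = refl
      site′-corner 0F with v ≟ v
      ... | yes _   = refl
      ... | no  v≢v = contradiction refl v≢v

      site′-old : ∀ u → u ≢ v → site′ (old u) ≡ site u
      site′-old u u≢v with u ≟ v
      ... | yes u≡v = contradiction u≡v u≢v
      ... | no  _   = refl

      kind-old : ∀ u i → u ≢ v → kind (old u , i) ≡ lifted (u , i)
      kind-old u i u≢v = trans (cong kind (≡-sym (emb-old u i u≢v))) (kind-emb (lifted (u , i)))

      colour′ : V′ → B
      colour′ = colour ∘ π

      crossingᴷ : ∀ k → (Σ (Dart B) λ e → emb k ≡ emb (lifted (ι e))) ⊎ colour′ (proj₁ (emb k)) ≡ colour′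
          (proj₁ (emb (αᴷ k)))
      crossingᴷ (fwd i) = inj₂ (cong colour (trans (π-corner i) (≡-sym (π-corner (next i)))))
      crossingᴷ (bwd i) = inj₂ (cong colour (trans (π-corner i) (≡-sym (π-corner (prev i)))))
      crossingᴷ (lifted d) with crossing d
      ... | inj₁ (e , refl) = inj₁ (e , refl)
      ... | inj₂ eq = inj₂ (trans (cong colour (π-lifted d))
          (trans eq (≡-sym (cong colour (π-lifted (α M d))))))

      -- Both triangle darts at corner `i` receive `mid i`. The interpolated values of two corners
      -- differ by at most `1`, and the arm left at corner `i` bridges the difference to
      -- `y (v , i)`.
      module Extend (y : Dart (Fin n) → ℕ)
                    (within : ∀ v i j → y (v , i) ≤ y (v , j) + slack (site v) i j)
                    (across : ∀ d → colour (proj₁ d) ≡ colour (proj₁ (α M d)) → y d ≤ suc (y (α M d))) where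

        open Interpolation (λ i → y (v , i)) ρ
          (λ i j i≢j → ≤-trans (within v i j)
              (+-monoʳ-≤ (y (v , j)) (slack-shrink (site v) positive i j i≢j)))

        yᴷ : Kind → ℕ
        yᴷ (lifted d) = y d
        yᴷ (fwd i)    = mid i
        yᴷ (bwd i)    = mid i

        y′ : Dart V′ → ℕ
        y′ = yᴷ ∘ kind

        y′-emb : ∀ k → y′ (emb k) ≡ yᴷ k
        y′-emb k = cong yᴷ (kind-emb k)

        corner-within : ∀ l i j → yᴷ (cornerKind l i) ≤ yᴷ (cornerKind l j) + slack (arm (ρ l)) i j
        corner-within l 0F 0F = m≤m+n _ _
        corner-within l 0F 1F = subst (λ r → y (v , l) ≤ mid l + r) (≡-sym (+-identityʳ (ρ l))) (≤mid l)
        corner-within l 0F 2F = subst (λ r → y (v , l) ≤ mid l + r) (≡-sym (+-identityʳ (ρ l))) (≤mid l)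
        corner-within l 1F 0F = mid≤ l
        corner-within l 2F 0F = mid≤ l
        corner-within l 1F 1F = m≤m+n _ _
        corner-within l 1F 2F = m≤m+n _ _
        corner-within l 2F 1F = m≤m+n _ _
        corner-within l 2F 2F = m≤m+n _ _

        within′ : ∀ x i j → y′ (x , i) ≤ y′ (x , j) + slack (site′ x) i j
        within′ x i j with place x
        ... | at-corner l   rewrite kind-corner l i | kind-corner l j | site′-corner l = corner-within l i j
        ... | outside u u≢v = subst₂ _≤_ (≡-sym (cong yᴷ (kind-old u i u≢v)))
          (≡-sym (cong₂ _+_ (cong yᴷ (kind-old u j u≢v)) (cong (λ σ → slack σ i j) (site′-old u u≢v))))
              (within u i j)

        acrossᴷ : ∀ k → colour′ (proj₁ (emb k)) ≡ colour′ (proj₁ (emb (αᴷ k))) → yᴷ k ≤ suc (yᴷ (αᴷ k))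
        acrossᴷ (lifted d) eq = across d
            (trans (≡-sym (cong colour (π-lifted d))) (trans eq (cong colour (π-lifted (α M d)))))
        acrossᴷ (fwd i)    eq = mid-near i (next i)
        acrossᴷ (bwd i)    eq = mid-near i (prev i)

        across′ : ∀ d → colour′ (proj₁ d) ≡ colour′ (proj₁ (α′ d)) → y′ d ≤ suc (y′ (α′ d))
        across′ = emb-elim _ λ k eq → subst₂ (λ a b → a ≤ suc b) (≡-sym (y′-emb k))
          (trans (≡-sym (y′-emb (αᴷ k))) (≡-sym (cong y′ (α′-emb k))))
          (acrossᴷ k (trans eq (cong (colour′ ∘ proj₁) (α′-emb k))))

      replace-sum : ∀ (f : Fin n → ℕ) (f′ : V′ → ℕ) → (∀ u → u ≢ v → f′ (old u) ≡ f u) →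
                    sum f′ + f v ≡ sum f + (f′ (corner 0F) + (f′ (corner 1F) + f′ (corner 2F)))
      replace-sum f f′ h = begin
        f′ zero + (f′ (suc zero) + sum (f′ ∘ old)) + f v
            ≡⟨ shuffle (f′ zero) (f′ (suc zero)) (sum (f′ ∘ old)) (f v) ⟩
        sum (f′ ∘ old) + f v + (f′ zero + f′ (suc zero))
            ≡⟨ cong (_+ (f′ zero + f′ (suc zero))) (sum-update (f′ ∘ old) f v h) ⟩
        sum f + f′ (old v) + (f′ zero + f′ (suc zero))      ≡⟨ +-assoc (sum f) _ _ ⟩
        sum f + (f′ (old v) + (f′ zero + f′ (suc zero)))    ∎
        where
        open ≡-Reasoning
        shuffle : ∀ a b c d → a + (b + c) + d ≡ c + d + (a + b)
        shuffle = solve-∀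

      budget-arm : ∀ i → budget (site′ (corner i)) ≡ ρ i
      budget-arm i = trans (cong budget (site′-corner i)) (+-identityʳ (ρ i))

      -- Each truncation spends exactly one unit, so the total budget is the measure on which
      -- `finish` recurses.
      budget′ : suc (sum (budget ∘ site′)) ≡ sum (budget ∘ site)
      budget′ = +-cancelʳ-≡ (total ρ) _ _ (begin
        suc (sum (budget ∘ site′)) + total ρ    ≡⟨ +-suc (sum (budget ∘ site′)) (total ρ) ⟨
        sum (budget ∘ site′) + suc (total ρ)
            ≡⟨ cong (sum (budget ∘ site′) +_) (budget-shrink (site v) positive) ⟨
        sum (budget ∘ site′) + budget (site v)
            ≡⟨ replace-sum (budget ∘ site) (budget ∘ site′) (λ u u≢v → cong budget (site′-old u u≢v)) ⟩
        sum (budget ∘ site) +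
            (budget (site′ (corner 0F)) + (budget (site′ (corner 1F)) + budget (site′ (corner 2F))))
          ≡⟨ cong (sum (budget ∘ site) +_)
              (cong₂ _+_ (budget-arm 0F) (cong₂ _+_ (budget-arm 1F) (budget-arm 2F))) ⟩
        sum (budget ∘ site) + total ρ           ∎)
        where open ≡-Reasoning

      -- A site of budget `b` is due to become `1 + 2 b` vertices, and three corners of budgets
      -- `ρ i` are due as many as the site they replace. The weight stays arbitrary so that one
      -- invariant yields both the order of the final map and the size of each fragment.
      mass′ : ∀ c → sum (λ x → c (colour′ x) * suc (2 * budget (site′ x))) ≡ K c
      mass′ c = trans (+-cancelʳ-≡ (f v) _ _ (begin
        sum f′ + f v
            ≡⟨ replace-sum f f′ (λ u u≢v → cong (λ σ → c (colour u) * suc (2 * budget σ)) (site′-old u u≢v)) ⟩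
        sum f + (f′ (corner 0F) + (f′ (corner 1F) + f′ (corner 2F)))
            ≡⟨ cong (sum f +_) (cong₂ _+_ (weigh 0F) (cong₂ _+_ (weigh 1F) (weigh 2F))) ⟩
        sum f + (w * suc (2 * ρ 0F) + (w * suc (2 * ρ 1F) + w * suc (2 * ρ 2F)))
                                                                    ≡⟨ cong (sum f +_) (collect w (ρ 0F)
                                                                        (ρ 1F) (ρ 2F)) ⟩
        sum f + w * suc (2 * suc (total ρ))
            ≡⟨ cong (λ b → sum f + w * suc (2 * b)) (budget-shrink (site v) positive) ⟨
        sum f + f v                                                 ∎)) (mass c)
        where
        open ≡-Reasoning
        w = c (colour v)
        f : Fin n → ℕ
        f u = c (colour u) * suc (2 * budget (site u))
        f′ : V′ → ℕ
        f′ x = c (colour′ x) * suc (2 * budget (site′ x))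
        weigh : ∀ i → f′ (corner i) ≡ w * suc (2 * ρ i)
        weigh i = cong₂ (λ u b → c (colour u) * suc (2 * b)) (π-corner i) (budget-arm i)
        collect : ∀ w a b c → w * suc (2 * a) + (w * suc (2 * b) + w * suc (2 * c)) ≡ w * suc
            (2 * suc (a + (b + c)))
        collect = solve-∀

      expansion′ : Expansion K (suc (suc n))
      expansion′ = record
        { M        = M′
        ; site     = site′
        ; colour   = colour′
        ; ι        = emb ∘ lifted ∘ ι
        ; ι-α      = λ d → trans (α′-emb (lifted (ι d))) (cong (emb ∘ lifted) (ι-α d))
        ; colour-ι = λ d → trans (cong colour (π-lifted (ι d))) (colour-ι d)
        ; crossing = emb-elim _ λ k →
            subst (λ e → (Σ (Dart B) λ d → emb k ≡ emb (lifted (ι d))) ⊎ colour′ (proj₁ (emb k)) ≡ colour′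
            (proj₁ e)) (≡-sym (α′-emb k)) (crossingᴷ k)
        ; extend   = λ x tame → let y , y-ι , within , across = extend x tame
                                    open Extend y within across
                                in y′ , (λ d → trans (y′-emb (lifted (ι d))) (y-ι d)) , within′ , across′
        ; mass     = mass′
        ; faces    = faces′ faces
        ; euler    = trans (cong suc (+-suc F (F + 0))) (cong (2 +_) euler)
        ; connected = connected₃′ connected
        }

  Finished : ∀ {K n} → Expansion K n → Set
  Finished X = ∀ v → budget (Expansion.site X v) ≡ 0

  finish : ∀ {K n} (X : Expansion K n) → Σ ℕ λ N → Σ (Expansion K N) Finished
  finish X = go X _ refl
    where
    go : ∀ {K n} (X : Expansion K n) b → sum (budget ∘ Expansion.site X) ≡ b → Σ ℕ λ N →
        Σ (Expansion K N) Finished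
    go {n = n} X zero    eq = n , X , sum-zero _ eq
    go         X (suc b) eq with v , m , positive ← sum-positive _ eq =
      go (Shrink.expansion′ X v positive) b (suc-injective (trans (Shrink.budget′ X v positive) eq))

-- From maps to graphs

dec-witness : ∀ {A : Set} (a? : Dec A) → does a? ≡ true → A
dec-witness (yes a) refl = a

iterate-suc : ∀ {A : Set} (f : A → A) k x → iterate f (suc k) x ≡ iterate f k (f x)
iterate-suc f zero    x = refl
iterate-suc f (suc k) x = cong f (iterate-suc f k x)

-- The two elements may coincide: a singleton is handled as the removal of the same vertex twice.
small-subset : ∀ {n} (X : Subset n) → ∣ X ∣ < 3 →
               (∀ x → x ∉ X) ⊎ Σ (Fin n) λ a → Σ (Fin n) λ b → a ∈ X × b ∈ X × (∀ x → x ∈ X → x ≡ a ⊎ x ≡ b)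
small-subset X <3 with nonempty? X
... | no  empty = inj₁ λ x x∈X → empty (x , x∈X)
... | yes (a , a∈X) with nonempty? (X - a)
...   | no  empty = inj₂ (a , a , a∈X , a∈X , λ x x∈X → covered x x∈X (x ≟ a))
  where
  covered : ∀ x → x ∈ X → Dec (x ≡ a) → x ≡ a ⊎ x ≡ a
  covered x x∈X (yes x≡a) = inj₁ x≡a
  covered x x∈X (no  x≢a) = contradiction (x , x∈p∧x≢y⇒x∈p-y x∈X x≢a) empty
...   | yes (b , b∈Y) = inj₂ (a , b , a∈X , p─q⊆p X _ b∈Y , λ x x∈X → covered x x∈X (x ≟ a) (x ≟ b))
  where
  ∣Z∣<1 : ∣ (X - a) - b ∣ < 1
  ∣Z∣<1 = <-≤-trans (x∈p⇒∣p-x∣<∣p∣ b∈Y) (≤-pred (≤-trans (x∈p⇒∣p-x∣<∣p∣ a∈X) (≤-pred <3)))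
  covered : ∀ x → x ∈ X → Dec (x ≡ a) → Dec (x ≡ b) → x ≡ a ⊎ x ≡ b
  covered x x∈X (yes x≡a) _         = inj₁ x≡a
  covered x x∈X _         (yes x≡b) = inj₂ x≡b
  covered x x∈X (no  x≢a) (no x≢b)  = contradiction
    (<-≤-trans (x∈p⇒∣p-x∣<∣p∣ (x∈p∧x≢y⇒x∈p-y (x∈p∧x≢y⇒x∈p-y x∈X x≢a) x≢b)) (≤-pred ∣Z∣<1)) n≮0

module MapGraph {n} (M : CubicMap (Fin n)) where

  nb : Fin n → Fin 3 → Fin n
  nb u i = proj₁ (α M (u , i))

  nb-injective : ∀ u → Injective _≡_ _≡_ (nb u)
  nb-injective u {i} {j} eq = cong proj₂ (simple M (u , i) (u , j) refl eq)

  back : ∀ d → nb (proj₁ (α M d)) (proj₂ (α M d)) ≡ proj₁ d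
  back d = cong proj₁ (involutive M d)

  neighbour? : ∀ u w → Dec (Σ (Fin 3) λ i → nb u i ≡ w)
  neighbour? u w = any? λ i → nb u i ≟ w

  adjacent : Fin n → Fin n → Bool
  adjacent u w = does (neighbour? u w)

  adjacent⇒nb : ∀ u w → adjacent u w ≡ true → Σ (Fin 3) λ i → nb u i ≡ w
  adjacent⇒nb u w = dec-witness (neighbour? u w)

  nb⇒adjacent : ∀ u i → adjacent u (nb u i) ≡ true
  nb⇒adjacent u i = dec-true (neighbour? u (nb u i)) (i , refl)

  adjacent-sym⇒ : ∀ u w → adjacent u w ≡ true → adjacent w u ≡ true
  adjacent-sym⇒ u w eq with i , refl ← adjacent⇒nb u w eq =
    dec-true (neighbour? (nb u i) u) (proj₂ (α M (u , i)) , back (u , i))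

  adjacent-sym : ∀ u w → adjacent u w ≡ adjacent w u
  adjacent-sym u w with adjacent u w in p | adjacent w u in q
  ... | true  | true  = refl
  ... | false | false = refl
  ... | true  | false = trans (≡-sym (adjacent-sym⇒ u w p)) q
  ... | false | true  = trans (≡-sym p) (adjacent-sym⇒ w u q)

  graph : Graph
  graph = record
    { order  = n
    ; adj    = adjacent
    ; sym    = adjacent-sym
    ; irrefl = λ u → dec-false (neighbour? u u) λ { (i , eq) → loopless M (u , i) eq }
    }

  graph-cubic : Cubic graph
  graph-cubic u = ≤-antisym
    (covering⇒count≤ (adjacent u) (nb u) (adjacent⇒nb u))
    (injection⇒≤count (adjacent u) (nb u) (nb-injective u) (nb⇒adjacent u))

  -- Rotation system and faces of the graph

  rotate : Fin n → Fin n → Fin n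
  rotate u w with neighbour? u w
  ... | yes (i , _) = nb u (next i)
  ... | no  _       = w

  rotate-nb : ∀ u i → rotate u (nb u i) ≡ nb u (next i)
  rotate-nb u i with neighbour? u (nb u i)
  ... | yes (j , eq) = cong (nb u ∘ next) (nb-injective u eq)
  ... | no  none     = contradiction (i , refl) none

  rotate-closed : ∀ u w → adjacent u w ≡ true → adjacent u (rotate u w) ≡ true
  rotate-closed u w eq with i , refl ← adjacent⇒nb u w eq =
    trans (cong (adjacent u) (rotate-nb u i)) (nb⇒adjacent u (next i))

  iterate-rotate : ∀ u k i → iterate (rotate u) k (nb u i) ≡ nb u (iterate next k i)
  iterate-rotate u zero    i = refl
  iterate-rotate u (suc k) i = trans (cong (rotate u) (iterate-rotate u k i)) (rotate-nb u (iterate next k i))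

  rotate-cyclic : ∀ u w z → adjacent u w ≡ true → adjacent u z ≡ true → Σ ℕ λ k → iterate (rotate u) k w ≡ z
  rotate-cyclic u w z p q with i , refl ← adjacent⇒nb u w p | j , refl ← adjacent⇒nb u z q
    with k , eq ← iterate-next-reaches i j = k , trans (iterate-rotate u k i) (cong (nb u) eq)

  rotation : RotationSystem graph
  rotation = record { rot = rotate ; closed = rotate-closed ; cyclic = rotate-cyclic }

  ends : Dart (Fin n) → Fin n × Fin n
  ends d = proj₁ d , proj₁ (α M d)

  faceStep-ends : ∀ d → faceStep rotation (ends d) ≡ ends (step M d)
  faceStep-ends d = cong (proj₁ (α M d) ,_)
    (trans (cong (rotate (proj₁ (α M d))) (≡-sym (back d))) (rotate-nb (proj₁ (α M d)) (proj₂ (α M d))))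

  iterate-faceStep : ∀ {d e} → Star (_⟶_ M) d e → Σ ℕ λ k → iterate (faceStep rotation) k (ends d) ≡ ends e
  iterate-faceStep ε = 0 , refl
  iterate-faceStep (_◅_ {d} refl r) with k , eq ← iterate-faceStep r = suc k ,
    trans (iterate-suc (faceStep rotation) k (ends d))
        (trans (cong (iterate (faceStep rotation) k) (faceStep-ends d)) eq)

  module _ {F} (φ : Faces M (Fin F)) where
    open Faces φ

    faceOf : Fin n → Fin n → Fin F
    faceOf u w with neighbour? u w
    ... | yes (i , _) = face (u , i)
    ... | no  _       = face (u , 0F)

    faceOf-nb : ∀ u i → faceOf u (nb u i) ≡ face (u , i)
    faceOf-nb u i with neighbour? u (nb u i)
    ... | yes (j , eq) = cong (λ l → face (u , l)) (nb-injective u eq)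
    ... | no  none     = contradiction (i , refl) none

    faceOf-rotate : ∀ u w → adjacent u w ≡ true → faceOf w (rotate w u) ≡ faceOf u w
    faceOf-rotate u w eq with i , refl ← adjacent⇒nb u w eq = begin
      faceOf (nb u i) (rotate (nb u i) u)   ≡⟨ cong (faceOf (nb u i)) (cong proj₂ (faceStep-ends (u , i))) ⟩
      faceOf (nb u i) (nb (nb u i) (next (proj₂ (α M (u , i))))) ≡⟨ faceOf-nb (nb u i) _ ⟩
      face (step M (u , i))                 ≡⟨ face-step (u , i) ⟩
      face (u , i)                          ≡⟨ faceOf-nb u i ⟨
      faceOf u (nb u i)                     ∎
      where open ≡-Reasoning

    faceOf-orbit : ∀ u w u′ w′ → adjacent u w ≡ true → adjacent u′ w′ ≡ true → faceOf u w ≡ faceOf u′ w′ →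
                   Σ ℕ λ k → iterate (faceStep rotation) k (u , w) ≡ (u′ , w′)
    faceOf-orbit u w u′ w′ p q eq with i , refl ← adjacent⇒nb u w p | j , refl ← adjacent⇒nb u′ w′ q =
      iterate-faceStep (face-orbit (u , i) (u′ , j)
          (trans (≡-sym (faceOf-nb u i)) (trans eq (faceOf-nb u′ j))))

    graph-faces : HasFaces graph rotation F
    graph-faces = record
      { face    = faceOf
      ; invar   = faceOf-rotate
      ; sameOrb = faceOf-orbit
      ; surj    = λ f → let u , i = onFace f in
                  u , nb u i , nb⇒adjacent u i , trans (faceOf-nb u i) (face-onFace f)
      }

    graph-planar : 2 * F ≡ n + 4 → Planar graph
    graph-planar euler = rotation , F , graph-faces , (begin
      2 * n + 2 * F     ≡⟨ cong (2 * n +_) euler ⟩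
      2 * n + (n + 4)   ≡⟨ regroup n ⟩
      n * 3 + 4         ≡⟨ cong (_+ 4) (trans (numDarts-sum graph) (sum-const (degree graph) 3 graph-cubic)) ⟨
      numDarts graph + 4 ∎)
      where
      open ≡-Reasoning
      regroup : ∀ n → 2 * n + (n + 4) ≡ n * 3 + 4
      regroup = solve-∀

  -- 3-connectivity of the graph

  walkAvoiding : ∀ {a b} {X : Subset n} → (∀ x → x ∈ X → x ≡ a ⊎ x ≡ b) → ∀ {u w} → u ∉ X →
                 Star (Link M a b) u w → WalkAvoiding graph X u w
  walkAvoiding cover {u} u∉X ε = record
    { len = 0 ; vert = λ _ → u ; start = refl ; end = refl ; step = λ () ; avoids = λ _ → u∉X }
  walkAvoiding {a} {b} {X} cover {u} u∉X (link d p (q , q′) ◅ r) = record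
    { len    = suc (W.len)
    ; vert   = λ { zero → u ; (suc i) → W.vert i }
    ; start  = refl
    ; end    = W.end
    ; step   = λ { zero → trans (cong (adjacent u) W.start) (nb⇒adjacent (proj₁ d) (proj₂ d)) ; (suc i) →
        W.step i }
    ; avoids = λ { zero → u∉X ; (suc i) → W.avoids i }
    }
    where
    t∉X : proj₁ (α M d) ∉ X
    t∉X t∈X with cover _ t∈X
    ... | inj₁ t≡a = q t≡a
    ... | inj₂ t≡b = q′ t≡b
    module W = WalkAvoiding (walkAvoiding cover t∉X r)

  -- `Connected₃` always removes at least one vertex; when nothing is to be removed, it is applied
  -- to a vertex away from both ends.
  fresh-vertex : ∀ u w → Σ (Fin n) λ z → u ≢ z × w ≢ z
  fresh-vertex u w with w ≟ nb u 0F
  ... | no  w≢ = nb u 0F , loopless M (u , 0F) ∘ ≡-sym , w≢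
  ... | yes w≡ = nb u 1F , loopless M (u , 1F) ∘ ≡-sym ,
                 λ eq → contradiction (nb-injective u (trans (≡-sym w≡) eq)) λ ()

  graph-3-connected : 3 < n → Connected₃ M → KConnected 3 graph
  graph-3-connected 3<n conn = 3<n , connectedMinus
    where
    connectedMinus : ∀ X → ∣ X ∣ < 3 → ConnectedMinus graph X
    connectedMinus X <3 u w u∉X w∉X with small-subset X <3
    ... | inj₁ empty with z , u≢z , w≢z ← fresh-vertex u w =
      walkAvoiding (λ x x∈X → contradiction x∈X (empty x)) u∉X (conn z z u w (u≢z , u≢z) (w≢z , w≢z))
    ... | inj₂ (a , b , a∈X , b∈X , cover) = walkAvoiding cover u∉X (conn a b u w (avoid u∉X) (avoid w∉X))
      where
      avoid : ∀ {x} → x ∉ X → Avoids a b x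
      avoid x∉X = (λ { refl → x∉X a∈X }) , λ { refl → x∉X b∈X }

  -- A cycle through a given edge

  data Path : Fin n → Fin n → List (Fin n) → Set where
    [_] : ∀ u → Path u u (u ∷ [])
    _∷_ : ∀ {u w z vs} → adjacent u w ≡ true → Path w z vs → Path u z (u ∷ vs)

  suffix : ∀ {u w z vs} → Path w z vs → Unique vs → u ∈ˡ vs → Σ (List (Fin n)) λ us →
           Path u z us × Unique us × (∀ {x} → x ∈ˡ us → x ∈ˡ vs)
  suffix p@([ _ ])   q       (here refl) = _ , p , q , id
  suffix p@(_ ∷ _)   q       (here refl) = _ , p , q , id
  suffix (e ∷ p)     (_ ∷ q) (there i)   with us , p′ , q′ , ⊆ ← suffix p q i = us , p′ , q′ , there ∘ ⊆

  -- Loop erasure.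
  simplePath : ∀ {a b u w} → u ≢ a → Star (Link M a b) u w → Σ (List (Fin n)) λ vs →
               Path u w vs × Unique vs × All (a ≢_) vs
  simplePath {u = u} u≢a ε = u ∷ [] , [ u ] , [] ∷ [] , (u≢a ∘ ≡-sym) ∷ []
  simplePath {a} u≢a (link (u , i) _ (w≢a , _) ◅ r) with simplePath w≢a r
  ... | vs , p , q , a∉ with anyˡ? (u ≟_) vs
  ...   | no  u∉vs = u ∷ vs , nb⇒adjacent u i ∷ p , ¬Any⇒All¬ vs u∉vs ∷ q , (u≢a ∘ ≡-sym) ∷ a∉
  ...   | yes u∈vs with us , p′ , q′ , ⊆ ← suffix p q u∈vs = us , p′ , q′ , All-tabulate (All-lookup a∉ ∘ ⊆)

  lookup-injective : ∀ {vs : List (Fin n)} → Unique vs → Injective _≡_ _≡_ (lookup vs)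
  lookup-injective {x ∷ vs} (p ∷ q) {zero}  {zero}  eq = refl
  lookup-injective {x ∷ vs} (p ∷ q) {zero}  {suc j} eq = contradiction eq (All-lookup p (∈-lookup j))
  lookup-injective {x ∷ vs} (p ∷ q) {suc i} {zero}  eq = contradiction (≡-sym eq) (All-lookup p (∈-lookup i))
  lookup-injective {x ∷ vs} (p ∷ q) {suc i} {suc j} eq = cong suc (lookup-injective q eq)

  closed-edges : ∀ {a u z vs} → Path u z vs → adjacent a u ≡ true → (i : Fin (length vs)) →
                 adjacent (lookup (a ∷ vs) (inject₁ i)) (lookup vs i) ≡ true
  closed-edges [ u ]   e zero    = e
  closed-edges (_ ∷ _) e zero    = e
  closed-edges (f ∷ p) e (suc i) = closed-edges p f i

  path-end : ∀ {u z vs} a → Path u z vs → lookup (a ∷ vs) (fromℕ (length vs)) ≡ z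
  path-end a [ u ]   = refl
  path-end a (e ∷ p) = path-end _ p

  -- Without `u`, two neighbours of `u` are still joined by a walk. Its loop erasure closes up
  -- through `u`, and the edge towards `nb u i` comes last.
  cycle-through : Connected₃ M → ∀ u i → Σ ℕ λ ℓ → Σ (Cycle graph (suc ℓ)) λ C →
                  Cycle.vert C zero ≡ u × Cycle.vert C (fromℕ ℓ) ≡ nb u i
  cycle-through conn u i = length vs , record
      { len≥3 = len≥3 p
      ; vert  = lookup (u ∷ vs)
      ; inj   = lookup-injective (u∉vs ∷ q)
      ; edges = edge
      } , refl , path-end u p
    where
    start≢ : ∀ j → nb u j ≢ u
    start≢ j = loopless M (u , j)
    found = simplePath (start≢ (next i))
        (conn u u (nb u (next i)) (nb u i) (start≢ _ , start≢ _) (start≢ _ , start≢ _))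
    vs   = proj₁ found
    p    = proj₁ (proj₂ found)
    q    = proj₁ (proj₂ (proj₂ found))
    u∉vs = proj₂ (proj₂ (proj₂ found))
    len≥3 : ∀ {vs} → Path (nb u (next i)) (nb u i) vs → 3 ≤ suc (length vs)
    len≥3 p = go refl refl p
      where
      go : ∀ {x y vs} → x ≡ nb u (next i) → y ≡ nb u i → Path x y vs → 3 ≤ suc (length vs)
      go e f [ _ ] = contradiction (nb-injective u (trans (≡-sym e) f)) (next≢ i)
      go e f (_ ∷ [ _ ])   = s≤s (s≤s (s≤s z≤n))
      go e f (_ ∷ (_ ∷ _)) = s≤s (s≤s (s≤s z≤n))
    edge : ∀ j → adjacent (lookup (u ∷ vs) j) (lookup (u ∷ vs) (next j)) ≡ true
    edge j with view j
    ... | ‵fromℕ     = subst₂ (λ x k → adjacent x (lookup (u ∷ vs) k) ≡ true) (≡-sym (path-end u p))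
        (≡-sym (next-fromℕ (length vs)))
                         (adjacent-sym⇒ u (nb u i) (nb⇒adjacent u i))
    ... | ‵inject₁ k = subst (λ l → adjacent (lookup (u ∷ vs) (inject₁ k)) (lookup (u ∷ vs) l) ≡ true)
        (≡-sym (next-inject₁ k))
                         (closed-edges p (nb⇒adjacent u (next i)) k)

-- Cycles of a truncated map

argmin : ∀ {m} (f : Fin (suc m) → ℕ) → Σ (Fin (suc m)) λ i → ∀ j → f i ≤ f j
argmin {zero}  f = zero , λ { zero → ≤-refl }
argmin {suc m} f with i , least ← argmin (f ∘ suc) with ≤-total (f zero) (f (suc i))
... | inj₁ z≤ = zero , λ { zero → ≤-refl ; (suc j) → ≤-trans z≤ (least j) }
... | inj₂ ≤z = suc i , λ { zero → ≤z ; (suc j) → least j }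

indicator : {B : Set} → DecidableEquality B → B → B → ℕ
indicator _≟ᴮ_ h b = if does (b ≟ᴮ h) then 1 else 0

Within : ℕ → ℕ → ℕ → Set
Within t a b = a ≤ b + t × b ≤ a + t

-- From `next i` the cycle returns to `i` in `m` steps, none of which leaves `i`. An early return
-- need not be excluded: the bound then holds already and only widens.
cyclic-Lipschitz : ∀ {m} (f : Fin (suc m) → ℕ) i → (∀ j → j ≢ i → Within 1 (f j) (f (next j))) →
                   Within m (f (next i)) (f i)
cyclic-Lipschitz {m} f i h = finish′ (go m)
  where
  s = next i
  widen : ∀ {t a b} → Within t a b → Within (suc t) a b
  widen {t} {a} {b} (p , q) = ≤-trans p (+-monoʳ-≤ b (n≤1+n t)) , ≤-trans q (+-monoʳ-≤ a (n≤1+n t))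
  chain : ∀ {t} a b c → a ≤ b + t → b ≤ c + 1 → a ≤ c + suc t
  chain {t} a b c p q = ≤-trans p (≤-trans (+-monoˡ-≤ t q) (≤-reflexive (+-assoc c 1 t)))
  chain′ : ∀ {t} a b c → b ≤ a + t → c ≤ b + 1 → c ≤ a + suc t
  chain′ {t} a b c p q = ≤-trans q
      (≤-trans (+-monoˡ-≤ 1 p) (≤-reflexive (trans (+-assoc a t 1) (cong (a +_) (+-comm t 1)))))
  go : ∀ t → Within t (f s) (f i) ⊎ Within t (f s) (f (iterate next t s))
  go zero = inj₂ (≤-reflexive (≡-sym (+-identityʳ _)) , ≤-reflexive (≡-sym (+-identityʳ _)))
  go (suc t) with go t
  ... | inj₁ w = inj₁ (widen w)
  ... | inj₂ (p , q) with iterate next t s ≟ i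
  ...   | yes eq = inj₁ (widen (subst (λ j → Within t (f s) (f j)) eq (p , q)))
  ...   | no  ≢i = inj₂
      (chain _ (f (iterate next t s)) _ p (proj₁ (h _ ≢i)) , chain′ _ (f (iterate next t s)) _ q
      (proj₂ (h _ ≢i)))
  finish′ : Within m (f s) (f i) ⊎ Within m (f s) (f (iterate next m s)) → Within m (f s) (f i)
  finish′ (inj₁ w) = w
  finish′ (inj₂ w) = subst (λ j → Within m (f s) (f j))
      (trans (≡-sym (iterate-suc next m i)) (iterate-next-period i)) w

module _ {B : Set} (H : CubicMap B) (γ : B → Fin 3 → ℕ) (rk : Dart B → ℕ) (L : ℕ) where

  -- A potential showing that a cycle through e whose other crossing darts all
  -- have rank at least rk e has more than L vertices.
  Barrier : Dart B → Set
  Barrier e = Σ (Dart B → ℕ) λ x → Tame H γ x ×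
    (∀ d → d ≢ e → d ≢ α H e → rk e ≤ rk d → x d ≤ suc (x (α H d))) × x e + L ≤ x (α H e)

  -- With the other two edges at `u` absent, a cycle entering `u` cannot leave again. The
  -- certificate is the potential with value `L` at `u` and `0` elsewhere.
  pendant : DecidableEquality B → (∀ d → rk (α H d) ≡ rk d) → ∀ u i →
            (∀ j → j ≢ i → rk (u , j) < rk (u , i)) → Barrier (α H (u , i))
  pendant _≟ᴮ_ rk-α u i others = (x ∘ proj₁) , (λ h i j → m≤m+n _ _) , lip ,
      ≤-reflexive (trans (cong (_+ L) (x-other (loopless H (u , i))))
          (trans (≡-sym x-u) (cong (x ∘ proj₁) (≡-sym (involutive H (u , i))))))
    where
    x : B → ℕ
    x b = if does (b ≟ᴮ u) then L else 0
    x-u : x u ≡ L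
    x-u rewrite dec-true (u ≟ᴮ u) refl = refl
    x-other : ∀ {b} → b ≢ u → x b ≡ 0
    x-other {b} b≢u rewrite dec-false (b ≟ᴮ u) b≢u = refl
    lip : ∀ d → d ≢ α H (u , i) → d ≢ α H (α H (u , i)) → rk (α H (u , i)) ≤ rk d → x (proj₁ d) ≤ suc
        (x (proj₁ (α H d)))
    lip (b , j) _ ≢e le with b ≟ᴮ u
    ... | no  _    = z≤n
    ... | yes refl = contradiction (≤-trans (≤-reflexive (≡-sym (rk-α (u , i)))) le)
      (<⇒≱ (others j λ { refl → ≢e (≡-sym (involutive H (u , i))) }))

  module Gap (rk-α : ∀ d → rk (α H d) ≡ rk d) {top : ℕ} (rk<top : ∀ d → rk d < top)
             (barrier : ∀ e → Barrier e ⊎ Barrier (α H e))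
             {K n} (X : Expansion H γ K n) (fin : Finished H γ X) where

    open Expansion X
    open MapGraph M

    slack≡0 : ∀ v i j → slack (site v) i j ≡ 0
    slack≡0 v i j = trans (cong₂ (λ a b → core (site v) + (a + b)) (leg≡0 i) (leg≡0 j))
        (trans (+-identityʳ _) (m+n≡0⇒m≡0 (core (site v)) (fin v)))
      where
      legs : total (leg (site v)) ≡ 0
      legs = m+n≡0⇒n≡0 (core (site v)) (fin v)
      leg≡0 : ∀ i → leg (site v) i ≡ 0
      leg≡0 0F = m+n≡0⇒m≡0 _ legs
      leg≡0 1F = m+n≡0⇒m≡0 _ (m+n≡0⇒n≡0 (leg (site v) 0F) legs)
      leg≡0 2F = m+n≡0⇒n≡0 (leg (site v) 1F) (m+n≡0⇒n≡0 (leg (site v) 0F) legs)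

    -- A dart inside a fragment costs more than any crossing dart, so a minimal cost of `top` means
    -- that the cycle never leaves its fragment.
    rk-of : ∀ d → (Σ (Dart B) λ e → d ≡ ι e) ⊎ colour (proj₁ d) ≡ colour (proj₁ (α M d)) → ℕ
    rk-of d (inj₁ (e , _)) = rk e
    rk-of d (inj₂ _)       = top

    module OnCycle {m} (C : Cycle graph (suc m)) where
      open Cycle C

      dart : Fin (suc m) → Dart (Fin n)
      dart j = vert j , proj₁ (adjacent⇒nb (vert j) (vert (next j)) (edges j))

      target : ∀ j → proj₁ (α M (dart j)) ≡ vert (next j)
      target j = proj₂ (adjacent⇒nb (vert j) (vert (next j)) (edges j))

      cost : Fin (suc m) → ℕ
      cost j = rk-of (dart j) (crossing (dart j))

      Monochromatic : Set
      Monochromatic = ∀ j → colour (vert j) ≡ colour (vert (next j))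

      module Crossing (i : Fin (suc m)) (e : Dart B) (i-e : dart i ≡ ι e) (least : ∀ j → rk e ≤ cost j) where

        same-edge : ∀ {a d} → a ≡ e ⊎ a ≡ α H e → d ≡ a ⊎ d ≡ α H a → d ≡ e ⊎ d ≡ α H e
        same-edge a-e         (inj₁ refl) = a-e
        same-edge (inj₁ refl) (inj₂ refl) = inj₂ refl
        same-edge (inj₂ refl) (inj₂ refl) = inj₁ (involutive H e)

        rk-same : ∀ {a} → a ≡ e ⊎ a ≡ α H e → rk a ≡ rk e
        rk-same (inj₁ refl) = refl
        rk-same (inj₂ refl) = rk-α e

        -- Both orientations of the crossed edge are covered, since the barrier is available for `e`
        -- or for its reverse.
        module _ (a : Dart B) (a-e : a ≡ e ⊎ a ≡ α H e) (x : Dart B → ℕ) (tame : Tame H γ x)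
                 (lip : ∀ d → d ≢ a → d ≢ α H a → rk a ≤ rk d → x d ≤ suc (x (α H d))) where

          y = proj₁ (extend x tame)
          y-ι = proj₁ (proj₂ (extend x tame))
          within = proj₁ (proj₂ (proj₂ (extend x tame)))
          across = proj₂ (proj₂ (proj₂ (extend x tame)))

          -- All slacks vanish once the truncation is finished, so the potential agrees on the three
          -- darts of a vertex and any of them represents it.
          φ : Fin n → ℕ
          φ v = y (v , 0F)

          y≤φ : ∀ d → y d ≤ φ (proj₁ d)
          y≤φ (v , i) = ≤-trans (within v i 0F)
              (≤-reflexive (trans (cong (φ v +_) (slack≡0 v i 0F)) (+-identityʳ _)))

          φ≤y : ∀ d → φ (proj₁ d) ≤ y d
          φ≤y (v , i) = ≤-trans (within v 0F i)
              (≤-reflexive (trans (cong (y (v , i) +_) (slack≡0 v 0F i)) (+-identityʳ _)))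

          lip′ : ∀ d → d ≢ e → d ≢ α H e → rk e ≤ rk d → x d ≤ suc (x (α H d))
          lip′ d d≢e d≢αe le = lip d (λ eq → neither (same-edge a-e (inj₁ eq)))
              (λ eq → neither (same-edge a-e (inj₂ eq))) (≤-trans (≤-reflexive (rk-same a-e)) le)
            where
            neither : ¬ (d ≡ e ⊎ d ≡ α H e)
            neither (inj₁ eq) = d≢e eq
            neither (inj₂ eq) = d≢αe eq

          y-step : ∀ d → (∀ e′ → d ≡ ι e′ → e′ ≢ e × e′ ≢ α H e) → rk e ≤ rk-of d (crossing d) →
                   y d ≤ suc (y (α M d)) × y (α M d) ≤ suc (y d)
          y-step d other le with crossing d
          ... | inj₂ mono = across d mono ,
            subst (λ z → y (α M d) ≤ suc (y z)) (involutive M d) (across (α M d)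
              (trans (≡-sym mono) (cong (colour ∘ proj₁) (≡-sym (involutive M d)))))
          ... | inj₁ (e′ , refl) =
              subst₂ (λ p q → p ≤ suc q) (≡-sym (y-ι e′)) tgt
                  (lip′ e′ (proj₁ (other e′ refl)) (proj₂ (other e′ refl)) le) ,
              subst₂ (λ p q → p ≤ suc q) tgt (trans (cong x (involutive H e′)) (≡-sym (y-ι e′)))
                (lip′ (α H e′) (λ eq → proj₂ (other e′ refl)
                    (trans (≡-sym (involutive H e′)) (cong (α H) eq)))
                  (λ eq → proj₁ (other e′ refl)
                      (trans (≡-sym (involutive H e′)) (trans (cong (α H) eq) (involutive H e))))
                  (≤-trans le (≤-reflexive (≡-sym (rk-α e′)))))
            where
            tgt : x (α H e′) ≡ y (α M (ι e′))
            tgt = trans (≡-sym (y-ι (α H e′))) (cong y (≡-sym (ι-α e′)))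

          2≤m′ : 2 ≤ m
          2≤m′ with s≤s p ← len≥3 = p

          turn-back : ∀ {m} (i j : Fin (suc m)) → 2 ≤ m → j ≡ next i → next j ≢ i
          turn-back i j 2≤m refl = next-aperiodic 1 (s≤s 2≤m) i

          -- The crossed edge is used only once: a second passage in the same direction repeats a
          -- vertex, and one in the opposite direction would close the cycle after two steps.
          other : ∀ j → j ≢ i → ∀ e′ → dart j ≡ ι e′ → e′ ≢ e × e′ ≢ α H e
          other j j≢i e′ j-e = (λ { refl → j≢i (inj (cong proj₁ (trans j-e (≡-sym i-e)))) }) ,
            λ { refl → turn-back i j 2≤m′
                  (inj (trans (cong proj₁ (trans j-e (trans (≡-sym (ι-α e)) (cong (α M) (≡-sym i-e)))))
                      (target i)))
                  (inj (trans (≡-sym (target j))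
                      (cong proj₁ (trans (cong (α M) j-e)
                      (trans (ι-α (α H e)) (trans (cong ι (involutive H e)) (≡-sym i-e))))))) }

          φ-step : ∀ j → j ≢ i → Within 1 (φ (vert j)) (φ (vert (next j)))
          φ-step j j≢i with p , q ← y-step (dart j) (other j j≢i) (least j) =
            +1 (≤-trans (φ≤y (dart j))
                (≤-trans p (s≤s (subst (λ v → y (α M (dart j)) ≤ φ v) (target j) (y≤φ (α M (dart j))))))) ,
            +1 (≤-trans (subst (λ v → φ v ≤ y (α M (dart j))) (target j) (φ≤y (α M (dart j))))
                (≤-trans q (s≤s (y≤φ (dart j)))))
            where
            +1 : ∀ {p q} → p ≤ suc q → p ≤ q + 1
            +1 {q = q} h = ≤-trans h (≤-reflexive (+-comm 1 q))

          near-ends : Within m (x (α H e)) (x e)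
          near-ends = subst₂ (Within m)
              (≤-antisym′ (subst (λ v → φ v ≤ y (α M (dart i))) (target i) (φ≤y _))
                  (subst (λ v → y (α M (dart i)) ≤ φ v) (target i) (y≤φ _))
                (trans (cong (y ∘ α M) i-e) (trans (cong y (ι-α e)) (y-ι (α H e)))))
              (≤-antisym′ (φ≤y (dart i)) (y≤φ (dart i)) (trans (cong y i-e) (y-ι e)))
              (cyclic-Lipschitz (φ ∘ vert) i φ-step)
            where
            ≤-antisym′ : ∀ {p q r} → p ≤ q → q ≤ p → q ≡ r → p ≡ r
            ≤-antisym′ p q refl = ≤-antisym p q

        long : L ≤ m
        long with barrier e
        ... | inj₁ (x , tame , lip , jump) =
          +-cancelˡ-≤ (x e) L m (≤-trans jump (proj₁ (near-ends e (inj₁ refl) x tame lip)))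
        ... | inj₂ (x , tame , lip , jump) =
          +-cancelˡ-≤ (x (α H e)) L m (≤-trans jump (≤-trans (≤-reflexive (cong x (involutive H e)))
            (proj₂ (near-ends (α H e) (inj₂ refl) x tame lip))))

      monochromatic⊎long : Monochromatic ⊎ L < suc m
      monochromatic⊎long with i , least ← argmin cost = at-min i least
        where
        at-min : ∀ i → (∀ j → cost i ≤ cost j) → Monochromatic ⊎ L < suc m
        at-min i least with crossing (dart i) in eq
        ... | inj₁ (e , i-e) = inj₂ (s≤s (Crossing.long i e i-e least))
        ... | inj₂ _ = inj₁ mono
          where
          mono : Monochromatic
          mono j with crossing (dart j) | least j
          ... | inj₁ (e , _) | le = contradiction le (<⇒≱ (rk<top e))
          ... | inj₂ same    | _  = trans same (cong colour (target j))

      constant : Monochromatic → ∀ j → colour (vert j) ≡ colour (vert zero)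
      constant mono j = subst (λ l → colour (vert l) ≡ colour (vert zero)) (iterate-next _ j refl)
          (go (toℕ j))
        where
        go : ∀ t → colour (vert (iterate next t zero)) ≡ colour (vert zero)
        go zero    = refl
        go (suc t) = trans (≡-sym (mono (iterate next t zero))) (go t)

      module _ (_≟ᴮ_ : DecidableEquality B) where

        short : Monochromatic → suc m ≤ K (indicator _≟ᴮ_ (colour (vert zero)))
        short mono = begin
          suc m
              ≤⟨ injection⇒≤count p vert inj (λ j → dec-true (colour (vert j) ≟ᴮ h) (constant mono j)) ⟩
          count p                                        ≡⟨ count-sum p ⟩
          sum (λ v → indicator _≟ᴮ_ h (colour v))             ≡⟨ sum-cong (λ v → trans (≡-sym (*-identityʳ _))
                                                               (cong (λ b → indicator _≟ᴮ_ h
                                                                   (colour v) * suc (2 * b))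
                                                                   (≡-sym (fin v)))) ⟩
          sum (λ v → indicator _≟ᴮ_ h (colour v) * suc (2 * budget (site v))) ≡⟨ mass (indicator _≟ᴮ_ h) ⟩
          K (indicator _≟ᴮ_ h)                                ∎
          where
          open ≤-Reasoning
          h = colour (vert zero)
          p = λ v → does (colour v ≟ᴮ h)

    -- A cycle through a crossing edge meets two colours, so the dichotomy makes it long; this gives
    -- the circumference.
    long-cycle : Dart B → Σ ℕ λ ℓ → L < ℓ × Cycle graph ℓ
    long-cycle e with ℓ , C , first , last ← cycle-through connected (proj₁ (ι e)) (proj₂ (ι e))
      with OnCycle.monochromatic⊎long C
    ... | inj₂ long = suc ℓ , long , C
    ... | inj₁ mono = contradiction (begin-eq) (loopless H e)
      where
      open Cycle C
      begin-eq : proj₁ (α H e) ≡ proj₁ e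
      begin-eq = trans (≡-sym (colour-ι (α H e))) (trans (cong (colour ∘ proj₁) (≡-sym (ι-α e)))
        (trans (cong colour (≡-sym last))
            (trans (mono (fromℕ ℓ))
            (trans (cong (colour ∘ vert) (next-fromℕ ℓ)) (trans (cong colour first) (colour-ι e))))))

-- The base map

pattern stay  = 0F
pattern ahead = 1F
pattern back  = 2F

opposite : Fin 3 → Fin 3
opposite stay  = stay
opposite ahead = back
opposite back  = ahead

-- The base map H consists of five concentric rings. A sector meets them in the
-- slots 0 | 1, 2 | 3, 4 | 5, 6 | 7, and slot 2 b is joined upwards to slot
-- 2 b + 1 in the same sector.
--
-- Where dart d at slot s leads: a shift of the sector, a slot, and the index
-- of the reverse dart. Dart 0 is vertical; the darts 1 and 2 point to the left
-- and to the right at even slots, and the other way round at odd slots.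
move : Fin 8 → Fin 3 → Fin 3 × Fin 8 × Fin 3
move 0F 0F = stay  , 1F , 0F
move 0F 1F = back  , 0F , 2F
move 0F 2F = ahead , 0F , 1F
move 1F 0F = stay  , 0F , 0F
move 1F 1F = stay  , 2F , 1F
move 1F 2F = back  , 2F , 2F
move 2F 0F = stay  , 3F , 0F
move 2F 1F = stay  , 1F , 1F
move 2F 2F = ahead , 1F , 2F
move 3F 0F = stay  , 2F , 0F
move 3F 1F = stay  , 4F , 1F
move 3F 2F = back  , 4F , 2F
move 4F 0F = stay  , 5F , 0F
move 4F 1F = stay  , 3F , 1F
move 4F 2F = ahead , 3F , 2F
move 5F 0F = stay  , 4F , 0F
move 5F 1F = ahead , 6F , 1F
move 5F 2F = stay  , 6F , 2F
move 6F 0F = stay  , 7F , 0F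
move 6F 1F = back  , 5F , 1F
move 6F 2F = stay  , 5F , 2F
move 7F 0F = stay  , 6F , 0F
move 7F 1F = ahead , 7F , 2F
move 7F 2F = back  , 7F , 1F

turnOf : Fin 8 → Fin 3 → Fin 3
turnOf s d = proj₁ (move s d)

slotOf : Fin 8 → Fin 3 → Fin 8
slotOf s d = proj₁ (proj₂ (move s d))

dartOf : Fin 8 → Fin 3 → Fin 3
dartOf s d = proj₂ (proj₂ (move s d))

move-involutive : ∀ s d → move (slotOf s d) (dartOf s d) ≡ (opposite (turnOf s d) , s , d)
move-involutive = from-yes
    (all? λ s → all? λ d → ≡-dec _≟_ (≡-dec _≟_ _≟_) (move (slotOf s d) (dartOf s d))
    (opposite (turnOf s d) , s , d))

move-loopless : ∀ s d → slotOf s d ≡ s → turnOf s d ≢ stay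
move-loopless = from-yes (all? λ s → all? λ d → (slotOf s d ≟ s) →-dec ¬? (turnOf s d ≟ stay))

move-simple : ∀ s d e → slotOf s d ≡ slotOf s e → turnOf s d ≡ turnOf s e → d ≡ e
move-simple = from-yes (all? λ s → all? λ d → all? λ e →
  (slotOf s d ≟ slotOf s e) →-dec ((turnOf s d ≟ turnOf s e) →-dec (d ≟ e)))

ring : Fin 8 → Fin 5
ring 0F = 0F
ring 1F = 1F
ring 2F = 1F
ring 3F = 2F
ring 4F = 2F
ring 5F = 3F
ring 6F = 3F
ring 7F = 4F

rightward leftward : Fin 8 → Fin 3
rightward 0F = 2F
rightward 1F = 1F
rightward 2F = 2F
rightward 3F = 1F
rightward 4F = 2F
rightward 5F = 1F
rightward 6F = 2F
rightward 7F = 1F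
leftward s = opposite (rightward s)

module Base (m : ℕ) where

  -- Three sectors already make `H` simple. The fourth separates both neighbours of a sector from
  -- one another even after one more step, as the relative positions in the tables require.
  Sector : Set
  Sector = Fin (4 + m)

  B : Set
  B = Sector × Fin 8

  shift : Fin 3 → Sector → Sector
  shift stay  i = i
  shift ahead i = next i
  shift back  i = prev i

  shift-opposite : ∀ σ i → shift (opposite σ) (shift σ i) ≡ i
  shift-opposite stay  i = refl
  shift-opposite ahead i = prev-next i
  shift-opposite back  i = next-prev i

  shift-injective : ∀ σ τ i → shift σ i ≡ shift τ i → σ ≡ τ
  shift-injective stay  stay  i eq = refl
  shift-injective ahead ahead i eq = refl
  shift-injective back  back  i eq = refl
  shift-injective stay  ahead i eq = contradiction (≡-sym eq) (next≢ i)
  shift-injective ahead stay  i eq = contradiction eq (next≢ i)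
  shift-injective stay  back  i eq = contradiction (≡-sym eq) (prev≢ i)
  shift-injective back  stay  i eq = contradiction eq (prev≢ i)
  shift-injective ahead back  i eq = contradiction eq (next≢prev i)
  shift-injective back  ahead i eq = contradiction (≡-sym eq) (next≢prev i)

  αᴴ : Dart B → Dart B
  αᴴ ((i , s) , d) = (shift (turnOf s d) i , slotOf s d) , dartOf s d

  αᴴ-involutive : ∀ d → αᴴ (αᴴ d) ≡ d
  αᴴ-involutive ((i , s) , d) = trans
    (cong (λ (σ , s′ , d′) → (shift σ (shift (turnOf s d) i) , s′) , d′) (move-involutive s d))
    (cong (λ j → (j , s) , d) (shift-opposite (turnOf s d) i))

  H : CubicMap B
  H = record
    { α          = αᴴ
    ; involutive = αᴴ-involutive
    ; loopless   = λ { ((i , s) , d) eq → move-loopless s d (,-injectiveʳ eq)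
        (shift-injective (turnOf s d) stay i (,-injectiveˡ eq)) }
    ; simple     = λ { ((i , s) , d) (_ , e) refl eq → cong ((i , s) ,_)
        (move-simple s d e (,-injectiveʳ eq)
            (shift-injective (turnOf s d) (turnOf s e) i (,-injectiveˡ eq))) }
    }

  iterate⇒Star : ∀ k d → Star (_⟶_ H) d (iterate (step H) k d)
  iterate⇒Star zero    d = ε
  iterate⇒Star (suc k) d = iterate⇒Star k d ◅◅ (refl ◅ ε)

  -- Faces of the base map

  Label : Set
  Label = Fin 2 ⊎ Sector × Fin 4

  -- The face to the right of a dart. In band b between the rings b and b + 1,
  -- face i lies between the radial edges of the sectors i and i + 1.
  data Side : Set where
    cap  : Fin 2 → Side
    band : Fin 3 → Fin 4 → Side

  side : Fin 8 → Fin 3 → Side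
  side 0F 0F = band stay 0F
  side 0F 1F = band back 0F
  side 0F 2F = cap 0F
  side 1F 0F = band back 0F
  side 1F 1F = band stay 0F
  side 1F 2F = band back 1F
  side 2F 0F = band stay 1F
  side 2F 1F = band back 1F
  side 2F 2F = band stay 0F
  side 3F 0F = band back 1F
  side 3F 1F = band stay 1F
  side 3F 2F = band back 2F
  side 4F 0F = band stay 2F
  side 4F 1F = band back 2F
  side 4F 2F = band stay 1F
  side 5F 0F = band back 2F
  side 5F 1F = band stay 2F
  side 5F 2F = band stay 3F
  side 6F 0F = band stay 3F
  side 6F 1F = band back 3F
  side 6F 2F = band back 2F
  side 7F 0F = band back 3F
  side 7F 1F = band stay 3F
  side 7F 2F = cap 1F

  label : Sector → Side → Label
  label i (cap c)    = inj₁ c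
  label i (band σ b) = inj₂ (shift σ i , b)

  faceᴴ : Dart B → Label
  faceᴴ ((i , s) , d) = label i (side s d)

  root : Label → Dart B
  root (inj₁ 0F)       = (zero , 0F) , 2F
  root (inj₁ 1F)       = (zero , 7F) , 2F
  root (inj₂ (i , 0F)) = (i , 0F) , 0F
  root (inj₂ (i , 1F)) = (i , 2F) , 0F
  root (inj₂ (i , 2F)) = (i , 4F) , 0F
  root (inj₂ (i , 3F)) = (i , 6F) , 0F

  faceᴴ-root : ∀ l → faceᴴ (root l) ≡ l
  faceᴴ-root (inj₁ 0F)       = refl
  faceᴴ-root (inj₁ 1F)       = refl
  faceᴴ-root (inj₂ (i , 0F)) = refl
  faceᴴ-root (inj₂ (i , 1F)) = refl
  faceᴴ-root (inj₂ (i , 2F)) = refl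
  faceᴴ-root (inj₂ (i , 3F)) = refl

  at : ∀ (b : Fin 4) {i j : Sector} → i ≡ j → _≡_ {A = Label} (inj₂ (i , b)) (inj₂ (j , b))
  at b = cong λ i → inj₂ (i , b)

  faceᴴ-step : ∀ d → faceᴴ (step H d) ≡ faceᴴ d
  faceᴴ-step ((i , 0F) , 0F) = refl
  faceᴴ-step ((i , 0F) , 1F) = refl
  faceᴴ-step ((i , 0F) , 2F) = refl
  faceᴴ-step ((i , 1F) , 0F) = refl
  faceᴴ-step ((i , 1F) , 1F) = refl
  faceᴴ-step ((i , 1F) , 2F) = refl
  faceᴴ-step ((i , 2F) , 0F) = refl
  faceᴴ-step ((i , 2F) , 1F) = refl
  faceᴴ-step ((i , 2F) , 2F) = at 0F (prev-next i)
  faceᴴ-step ((i , 3F) , 0F) = refl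
  faceᴴ-step ((i , 3F) , 1F) = refl
  faceᴴ-step ((i , 3F) , 2F) = refl
  faceᴴ-step ((i , 4F) , 0F) = refl
  faceᴴ-step ((i , 4F) , 1F) = refl
  faceᴴ-step ((i , 4F) , 2F) = at 1F (prev-next i)
  faceᴴ-step ((i , 5F) , 0F) = refl
  faceᴴ-step ((i , 5F) , 1F) = at 2F (prev-next i)
  faceᴴ-step ((i , 5F) , 2F) = refl
  faceᴴ-step ((i , 6F) , 0F) = refl
  faceᴴ-step ((i , 6F) , 1F) = refl
  faceᴴ-step ((i , 6F) , 2F) = refl
  faceᴴ-step ((i , 7F) , 0F) = refl
  faceᴴ-step ((i , 7F) , 1F) = at 3F (prev-next i)
  faceᴴ-step ((i , 7F) , 2F) = refl

  faceLength : Fin 4 → ℕ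
  faceLength 0F = 5
  faceLength 1F = 6
  faceLength 2F = 6
  faceLength 3F = 5

  band-period : ∀ i b → iterate (step H) (faceLength b) (root (inj₂ (i , b))) ≡ root (inj₂ (i , b))
  band-period i 0F = cong (λ j → (j , 0F) , 0F) (prev-next i)
  band-period i 1F = cong (λ j → (j , 2F) , 0F) (prev-next i)
  band-period i 2F = cong (λ j → (j , 4F) , 0F) (prev-next i)
  band-period i 3F = cong (λ j → (j , 6F) , 0F) (prev-next i)

  -- Two darts with the same label are joined through their common root, so each dart only has to be
  -- compared with its root.
  OnOrbit : Dart B → Set
  OnOrbit d = Star (_⟶_ H) (root (faceᴴ d)) d × Star (_⟶_ H) d (root (faceᴴ d))

  -- `d` comes `l` steps after the root, and the remaining `k` steps of the face lead back.
  band-orbit : ∀ i b d k l → k + l ≡ faceLength b → iterate (step H) l (root (inj₂ (i , b))) ≡ d →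
               Star (_⟶_ H) (root (inj₂ (i , b))) d × Star (_⟶_ H) d (root (inj₂ (i , b)))
  band-orbit i b d k l eq refl = iterate⇒Star l (root (inj₂ (i , b))) ,
    subst (Star (_⟶_ H) d)
        (trans (≡-sym (iterate-+ (step H) k l _))
        (trans (cong (λ t → iterate (step H) t (root (inj₂ (i , b)))) eq) (band-period i b)))
      (iterate⇒Star k d)

  lower-cap : ∀ i j → Star (_⟶_ H) ((i , 0F) , 2F) ((j , 0F) , 2F)
  lower-cap i j with k , refl ← iterate-next-reaches i j = go k
    where
    go : ∀ k → Star (_⟶_ H) ((i , 0F) , 2F) ((iterate next k i , 0F) , 2F)
    go zero    = ε
    go (suc k) = go k ◅◅ (refl ◅ ε)

  -- This face runs against the order of the sectors, so `next` is iterated from `j` to `i`.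
  upper-cap : ∀ i j → Star (_⟶_ H) ((i , 7F) , 2F) ((j , 7F) , 2F)
  upper-cap i j with k , refl ← iterate-next-reaches j i = go k
    where
    go : ∀ k → Star (_⟶_ H) ((iterate next k j , 7F) , 2F) ((j , 7F) , 2F)
    go zero    = ε
    go (suc k) = cong (λ i → (i , 7F) , 2F) (prev-next (iterate next k j)) ◅ go k

  onOrbit : ∀ d → OnOrbit d
  onOrbit ((i , 0F) , 2F) = lower-cap zero i , lower-cap i zero
  onOrbit ((i , 7F) , 2F) = upper-cap zero i , upper-cap i zero
  onOrbit ((i , 0F) , 0F) = band-orbit i 0F _ 5 0 refl refl
  onOrbit ((i , 0F) , 1F) = band-orbit (prev i) 0F _ 1 4 refl (cong (λ j → (j , 0F) , 1F) (next-prev i))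
  onOrbit ((i , 1F) , 0F) = band-orbit (prev i) 0F _ 2 3 refl (cong (λ j → (j , 1F) , 0F) (next-prev i))
  onOrbit ((i , 1F) , 1F) = band-orbit i 0F _ 4 1 refl refl
  onOrbit ((i , 1F) , 2F) = band-orbit (prev i) 1F _ 1 5 refl (cong (λ j → (j , 1F) , 2F) (next-prev i))
  onOrbit ((i , 2F) , 0F) = band-orbit i 1F _ 6 0 refl refl
  onOrbit ((i , 2F) , 1F) = band-orbit (prev i) 1F _ 2 4 refl (cong (λ j → (j , 2F) , 1F) (next-prev i))
  onOrbit ((i , 2F) , 2F) = band-orbit i 0F _ 3 2 refl refl
  onOrbit ((i , 3F) , 0F) = band-orbit (prev i) 1F _ 3 3 refl (cong (λ j → (j , 3F) , 0F) (next-prev i))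
  onOrbit ((i , 3F) , 1F) = band-orbit i 1F _ 5 1 refl refl
  onOrbit ((i , 3F) , 2F) = band-orbit (prev i) 2F _ 1 5 refl (cong (λ j → (j , 3F) , 2F) (next-prev i))
  onOrbit ((i , 4F) , 0F) = band-orbit i 2F _ 6 0 refl refl
  onOrbit ((i , 4F) , 1F) = band-orbit (prev i) 2F _ 2 4 refl (cong (λ j → (j , 4F) , 1F) (next-prev i))
  onOrbit ((i , 4F) , 2F) = band-orbit i 1F _ 4 2 refl refl
  onOrbit ((i , 5F) , 0F) = band-orbit (prev i) 2F _ 3 3 refl (cong (λ j → (j , 5F) , 0F) (next-prev i))
  onOrbit ((i , 5F) , 1F) = band-orbit i 2F _ 5 1 refl refl
  onOrbit ((i , 5F) , 2F) = band-orbit i 3F _ 1 4 refl (cong (λ j → (j , 5F) , 2F) (prev-next i))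
  onOrbit ((i , 6F) , 0F) = band-orbit i 3F _ 5 0 refl refl
  onOrbit ((i , 6F) , 1F) = band-orbit (prev i) 3F _ 2 3 refl (cong (λ j → (j , 6F) , 1F) (next-prev i))
  onOrbit ((i , 6F) , 2F) = band-orbit (prev i) 2F _ 4 2 refl (cong (λ j → (j , 6F) , 2F) (next-prev i))
  onOrbit ((i , 7F) , 0F) = band-orbit (prev i) 3F _ 3 2 refl (cong (λ j → (j , 7F) , 0F) (next-prev i))
  onOrbit ((i , 7F) , 1F) = band-orbit i 3F _ 4 1 refl refl

  facesᴴ : Faces H Label
  facesᴴ = record
    { face        = faceᴴ
    ; face-step   = faceᴴ-step
    ; face-orbit  = λ d e eq → subst (λ l → Star (_⟶_ H) d (root l)) eq (proj₂ (onOrbit d)) ◅◅ proj₁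
        (onOrbit e)
    ; onFace      = root
    ; face-onFace = faceᴴ-root
    }

  -- 3-connectivity of the base map

  right : B → B
  right (i , s) = proj₁ (αᴴ ((i , s) , rightward s))

  left : B → B
  left (i , s) = proj₁ (αᴴ ((i , s) , leftward s))

  left-right : ∀ u → left (right u) ≡ u
  left-right (i , s) = trans
    (cong (λ d → proj₁ (αᴴ ((shift (turnOf s (rightward s)) i , slotOf s (rightward s)) , d)))
        (≡-sym (reverse-rightward s)))
    (cong proj₁ (αᴴ-involutive ((i , s) , rightward s)))
    where
    reverse-rightward : ∀ s → dartOf s (rightward s) ≡ leftward (slotOf s (rightward s))
    reverse-rightward = from-yes (all? λ s → dartOf s (rightward s) ≟ leftward (slotOf s (rightward s)))

  ring-right : ∀ u → ring (proj₂ (right u)) ≡ ring (proj₂ u)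
  ring-right (i , s) = same-ring s
    where
    same-ring : ∀ s → ring (slotOf s (rightward s)) ≡ ring s
    same-ring = from-yes (all? λ s → ring (slotOf s (rightward s)) ≟ ring s)

  _↷_ : B → B → Set
  u ↷ w = right u ≡ w

  once-around : ∀ i j s → Star _↷_ (i , s) (j , s)
  once-around i j s with k , refl ← iterate-next-reaches i j = go k
    where
    sector : ∀ i s → Star _↷_ (i , s) (next i , s)
    sector i 0F = refl ◅ ε
    sector i 1F = refl ◅ refl ◅ ε
    sector i 2F = refl ◅ refl ◅ ε
    sector i 3F = refl ◅ refl ◅ ε
    sector i 4F = refl ◅ refl ◅ ε
    sector i 5F = refl ◅ refl ◅ ε
    sector i 6F = refl ◅ refl ◅ ε
    sector i 7F = refl ◅ ε
    go : ∀ k → Star _↷_ (i , s) (iterate next k i , s)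
    go zero    = ε
    go (suc k) = go k ◅◅ sector (iterate next k i) s

  around : ∀ i j s t → ring s ≡ ring t → Star _↷_ (i , s) (j , t)
  around i j s t eq with s ≟ t | slotOf s (rightward s) ≟ t
  ... | yes refl | _        = once-around i j s
  ... | no  _    | yes refl = refl ◅ once-around _ j _
  ... | no  s≢t  | no  ≢t   = contradiction eq (apart s t s≢t ≢t)
    where
    apart : ∀ s t → s ≢ t → slotOf s (rightward s) ≢ t → ring s ≢ ring t
    apart = from-yes (all? λ s → all? λ t → ¬? (s ≟ t) →-dec
        (¬? (slotOf s (rightward s) ≟ t) →-dec ¬? (ring s ≟ ring t)))

  free-sector : ∀ (i j : Sector) → Σ Sector λ z → z ≢ i × z ≢ j
  free-sector i j with next i ≟ j
  ... | no  ≢j   = next i , next≢ i , ≢j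
  ... | yes refl = next (next i) , next²≢ i , next≢ (next i)

  ringOf : B → Fin 5
  ringOf u = ring (proj₂ u)

  module Avoiding (a b : B) where

    W : B → B → Set
    W = Star (Link H a b)

    off-ring : ∀ {u w c} → ringOf u ≡ ringOf w → ringOf u ≢ ringOf c → w ≢ c
    off-ring eq off refl = off eq

    sweep : ∀ {u w} → ringOf u ≢ ringOf a → ringOf u ≢ ringOf b → Star _↷_ u w → W u w
    sweep ≢a ≢b ε = ε
    sweep {u@(_ , s)} ≢a ≢b (refl ◅ r) =
      link (u , rightward s) (off-ring {u} refl ≢a , off-ring {u} refl ≢b)
        (off-ring {u} (≡-sym (ring-right u)) ≢a , off-ring {u} (≡-sym (ring-right u)) ≢b)
      ◅ sweep (≢a ∘ trans (≡-sym (ring-right u))) (≢b ∘ trans (≡-sym (ring-right u))) r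

    -- A ring without `a` is a path with right end `left a`; sweeping two vertices to this common
    -- end connects them.
    sweep-to-a : ∀ {u} → u ≢ a → ringOf u ≢ ringOf b → Star _↷_ u a → W u (left a)
    sweep-to-a u≢a ≢b ε = contradiction refl u≢a
    sweep-to-a {u@(_ , s)} u≢a ≢b (refl ◅ r) with ≡-dec _≟_ _≟_ (right u) a
    ... | yes refl = subst (W u) (≡-sym (left-right u)) ε
    ... | no  ≢a   =
      link (u , rightward s) (u≢a , off-ring {u} refl ≢b) (≢a , off-ring {u} (≡-sym (ring-right u)) ≢b)
      ◅ sweep-to-a ≢a (≢b ∘ trans (≡-sym (ring-right u))) r

    within-ring : ∀ u w → ringOf u ≡ ringOf w → ringOf u ≢ ringOf b → u ≢ a → w ≢ a → W u w
    within-ring u@(i , s) w@(j , t) eq ≢b u≢a w≢a with ringOf u ≟ ringOf a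
    ... | no  ≢a = sweep ≢a ≢b (around i j s t eq)
    ... | yes ≡a = sweep-to-a u≢a ≢b (around i _ s _ ≡a) ◅◅
      reverse (Link-sym H) (sweep-to-a w≢a (≢b ∘ trans eq) (around j _ t _ (trans (≡-sym eq) ≡a)))

  -- The sector `z` contains neither removed vertex, so its slots form a spine meeting all rings. A
  -- ring with at most one removed vertex leads to the spine. If both lie on the ring of `u`, the
  -- vertical edge at `u` leads to a ring that contains neither.
  connectedᴴ : Connected₃ H
  connectedᴴ a b u w u-ok w-ok with z , z≢a , z≢b ← free-sector (proj₁ a) (proj₁ b) =
    home u u-ok ◅◅ reverse (Link-sym H) (home w w-ok)
    where
    open Avoiding a b using (W; within-ring)

    clean : ∀ s → Avoids a b (z , s)
    clean s = z≢a ∘ cong proj₁ , z≢b ∘ cong proj₁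

    down₁ : W (z , 1F) (z , 0F)
    down₁ = link ((z , 1F) , 0F) (clean 1F) (clean 0F) ◅ ε
    down₂ : W (z , 2F) (z , 0F)
    down₂ = link ((z , 2F) , 1F) (clean 2F) (clean 1F) ◅ down₁
    down₃ : W (z , 3F) (z , 0F)
    down₃ = link ((z , 3F) , 0F) (clean 3F) (clean 2F) ◅ down₂
    down₄ : W (z , 4F) (z , 0F)
    down₄ = link ((z , 4F) , 1F) (clean 4F) (clean 3F) ◅ down₃
    down₅ : W (z , 5F) (z , 0F)
    down₅ = link ((z , 5F) , 0F) (clean 5F) (clean 4F) ◅ down₄
    down₆ : W (z , 6F) (z , 0F)
    down₆ = link ((z , 6F) , 2F) (clean 6F) (clean 5F) ◅ down₅
    down₇ : W (z , 7F) (z , 0F)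
    down₇ = link ((z , 7F) , 0F) (clean 7F) (clean 6F) ◅ down₆

    down : ∀ s → W (z , s) (z , 0F)
    down 0F = ε
    down 1F = down₁
    down 2F = down₂
    down 3F = down₃
    down 4F = down₄
    down 5F = down₅
    down 6F = down₆
    down 7F = down₇

    vertical-leaves : ∀ s → ring (slotOf s 0F) ≢ ring s
    vertical-leaves = from-yes (all? λ s → ¬? (ring (slotOf s 0F) ≟ ring s))

    home : ∀ u → Avoids a b u → W u (z , 0F)
    home u@(i , s) (u≢a , u≢b) with ringOf u ≟ ringOf b | ringOf u ≟ ringOf a
    ... | no  ≢b | _      = within-ring u (z , s) refl ≢b u≢a (proj₁ (clean s)) ◅◅ down s
    ... | yes _  | no  ≢a = gmap id (Link-swap H)
        (Avoiding.within-ring b a u (z , s) refl ≢a u≢b (proj₂ (clean s))) ◅◅ down s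
    ... | yes ≡b | yes ≡a = link (u , 0F) (u≢a , u≢b) (u′≢a , off b ≡b ∘ cong ringOf) ◅
        (within-ring (proj₁ (αᴴ (u , 0F))) (z , slotOf s 0F) refl (off b ≡b) u′≢a
            (proj₁ (clean (slotOf s 0F))) ◅◅ down (slotOf s 0F))
      where
      off : ∀ c → ring s ≡ ringOf c → ring (slotOf s 0F) ≢ ringOf c
      off c eq eq′ = vertical-leaves s (trans eq′ (≡-sym eq))
      u′≢a : proj₁ (αᴴ (u , 0F)) ≢ a
      u′≢a = off a ≡a ∘ cong ringOf

-- Potentials on the base map

-- (p , q) stands for p + q t, where k = 6 + 2 t.
Form : Set
Form = ℕ × ℕ

_⊕_ : Form → Form → Form
(p , q) ⊕ (p′ , q′) = p + p′ , q + q′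

_≼_ : Form → Form → Set
(p , q) ≼ (p′ , q′) = p ≤ p′ × q ≤ q′

_≼?_ : ∀ a b → Dec (a ≼ b)
(p , q) ≼? (p′ , q′) = (p ≤? p′) ×-dec (q ≤? q′)

one : Form
one = 1 , 0

-- Slots 0 and 7 put everything on the vertical dart, away from the caps. A ring arm at slot 1 or 2
-- borders one pentagon and one hexagon, a vertical arm at slot 1 two pentagons; the pentagons of
-- band 0 lack one unit, so slot 1 puts exactly one unit on its vertical dart. Slots 5 and 6 mirror
-- slots 2 and 1.
armForm : Fin 8 → Fin 3 → Form
armForm 0F 0F = 1 , 1
armForm 1F 0F = 1 , 0
armForm 1F 2F = 0 , 1
armForm 2F 1F = 1 , 1
armForm 3F 2F = 1 , 1
armForm 4F 1F = 1 , 1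
armForm 5F 2F = 1 , 1
armForm 6F 0F = 1 , 0
armForm 6F 1F = 0 , 1
armForm 7F 0F = 1 , 1
armForm _  _  = 0 , 0

-- The order in which edges of H are tested: edge classes of smaller rank may be
-- assumed absent. Ties on the two cap rings are broken in rk.
rank₀ : Fin 8 → Fin 3 → ℕ
rank₀ 0F 0F = 7
rank₀ 1F 0F = 7
rank₀ 1F 1F = 5
rank₀ 1F 2F = 6
rank₀ 2F 0F = 4
rank₀ 2F 1F = 5
rank₀ 2F 2F = 6
rank₀ 3F 0F = 4
rank₀ 3F 1F = 2
rank₀ 3F 2F = 3
rank₀ 4F 0F = 1
rank₀ 4F 1F = 2
rank₀ 4F 2F = 3
rank₀ 5F 0F = 1
rank₀ 5F 1F = 6
rank₀ 5F 2F = 5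
rank₀ 6F 0F = 7
rank₀ 6F 1F = 6
rank₀ 6F 2F = 5
rank₀ 7F 0F = 7
rank₀ _  _  = 8

rank₀-move : ∀ s d → rank₀ (slotOf s d) (dartOf s d) ≡ rank₀ s d
rank₀-move = from-yes (all? λ s → all? λ d → rank₀ (slotOf s d) (dartOf s d) ≟ℕ rank₀ s d)

-- Many edges off the cap rings also change the sector; recording them as `stay` confines the
-- tie-breaking to the cap rings.
capTurn : Fin 8 → Fin 3 → Fin 3
capTurn 0F 1F = back
capTurn 0F 2F = ahead
capTurn 7F 1F = ahead
capTurn 7F 2F = back
capTurn _  _  = stay

capTurn-move : ∀ s d → capTurn (slotOf s d) (dartOf s d) ≡ opposite (capTurn s d)
capTurn-move = from-yes (all? λ s → all? λ d → capTurn (slotOf s d) (dartOf s d) ≟ opposite (capTurn s d))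

capTurn-turn : ∀ s d → capTurn s d ≡ stay ⊎ turnOf s d ≡ capTurn s d
capTurn-turn = from-yes (all? λ s → all? λ d → (capTurn s d ≟ stay) ⊎-dec (turnOf s d ≟ capTurn s d))

low⇒capTurn≡stay : ∀ s d → rank₀ s d < 8 → capTurn s d ≡ stay
low⇒capTurn≡stay = from-yes (all? λ s → all? λ d → (rank₀ s d <? 8) →-dec (capTurn s d ≟ stay))

rank₀≤8 : ∀ s d → rank₀ s d ≤ 8
rank₀≤8 = from-yes (all? λ s → all? λ d → rank₀ s d ≤? 8)

pattern before    = 0F
pattern same      = 1F
pattern after     = 2F
pattern elsewhere = 3F

-- `elsewhere` stands for a whole run of sectors, so it may be followed by itself or by `before`.
follows : Fin 4 → Fin 4 → Bool
follows before    same      = true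
follows same      after     = true
follows after     elsewhere = true
follows elsewhere elsewhere = true
follows elsewhere before    = true
follows _         _         = false

compatible : Fin 3 → Fin 4 → Fin 4 → Bool
compatible stay  r r′ = does (r ≟ r′)
compatible ahead r r′ = follows r r′
compatible back  r r′ = follows r′ r

Table : Set
Table = Fin 8 → Fin 3 → Fin 4 → Form

module _ (x : Table) (s₀ : Fin 8) (d₀ : Fin 3) where

  -- The edges across which a jump is allowed: those assumed absent by rank, and the tested edge in
  -- either direction.
  Exempt : Fin 8 → Fin 3 → Fin 4 → Fin 4 → Set
  Exempt s d r r′ = rank₀ s d < rank₀ s₀ d₀ ⊎ ((s ≡ s₀ × d ≡ d₀) × r ≡ same)
                    ⊎ ((slotOf s d ≡ s₀ × dartOf s d ≡ d₀) × r′ ≡ same)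

  -- The jump `(14 , 4)` is `2 k + 2`. The tested edge stays in its sector, so both of its ends are
  -- read at `same`; rank at most 7 keeps it clear of the tie-breaking on the caps.
  Certificate : Set
  Certificate =
    (∀ s d e r → x s d r ≼ (x s e r ⊕ (one ⊕ (armForm s d ⊕ armForm s e)))) ×
    (∀ s d r r′ → compatible (turnOf s d) r r′ ≡ true → Exempt s d r r′ ⊎
        (x s d r ≼ (one ⊕ x (slotOf s d) (dartOf s d) r′))) ×
    (x s₀ d₀ same ⊕ (14 , 4)) ≼ x (slotOf s₀ d₀) (dartOf s₀ d₀) same ×
    turnOf s₀ d₀ ≡ stay × rank₀ s₀ d₀ ≤ 7

  certificate? : Dec Certificate
  certificate? =
    (all? λ s → all? λ d → all? λ e → all? λ r → x s d r ≼?
        (x s e r ⊕ (one ⊕ (armForm s d ⊕ armForm s e)))) ×-dec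
    (all? λ s → all? λ d → all? λ r → all? λ r′ → (compatible (turnOf s d) r r′ ≟ᵇ true) →-dec
      (((rank₀ s d <? rank₀ s₀ d₀) ⊎-dec ((((s ≟ s₀) ×-dec (d ≟ d₀)) ×-dec (r ≟ same)) ⊎-dec
        (((slotOf s d ≟ s₀) ×-dec (dartOf s d ≟ d₀)) ×-dec (r′ ≟ same))))
      ⊎-dec (x s d r ≼? (one ⊕ x (slotOf s d) (dartOf s d) r′)))) ×-dec
    ((x s₀ d₀ same ⊕ (14 , 4)) ≼? x (slotOf s₀ d₀) (dartOf s₀ d₀) same) ×-dec
    ((turnOf s₀ d₀ ≟ stay) ×-dec (rank₀ s₀ d₀ ≤? 7))

row : Form → Form → Form → Form → Fin 4 → Form
row a b c d before    = a
row a b c d same      = b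
row a b c d after     = c
row a b c d elsewhere = d

-- Each potential is a distance from the tested dart in H minus the tested and
-- all lower-ranked edges, cut off at a constant far away; the two coefficients
-- were computed separately.
x₁ : Fin 8 → Fin 3 → Fin 4 → Form
x₁ 1F 2F = row (7 , 1) (7 , 2) (7 , 1) (7 , 1)
x₁ 2F 0F = row (7 , 2) (5 , 1) (5 , 1) (7 , 1)
x₁ 2F 2F = row (7 , 2) (6 , 1) (6 , 1) (7 , 1)
x₁ 3F 0F = row (7 , 2) (4 , 1) (4 , 1) (7 , 1)
x₁ 3F 1F = row (7 , 2) (3 , 1) (4 , 1) (7 , 1)
x₁ 3F 2F = row (7 , 2) (5 , 2) (2 , 0) (7 , 2)
x₁ 4F 0F = row (7 , 2) (0 , 0) (7 , 2) (7 , 2)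
x₁ 4F 1F = row (7 , 2) (2 , 1) (5 , 1) (7 , 1)
x₁ 4F 2F = row (6 , 2) (1 , 0) (7 , 2) (7 , 2)
x₁ 5F 0F = row (8 , 2) (14 , 4) (8 , 2) (7 , 2)
x₁ 5F 1F = row (9 , 2) (13 , 4) (8 , 2) (7 , 2)
x₁ 5F 2F = row (7 , 2) (12 , 3) (10 , 3) (7 , 2)
x₁ 6F 0F = row (7 , 2) (9 , 3) (10 , 3) (7 , 2)
x₁ 6F 1F = row (7 , 2) (10 , 2) (12 , 4) (7 , 2)
x₁ 6F 2F = row (7 , 2) (11 , 3) (11 , 3) (7 , 2)
x₁ 7F 0F = row (7 , 2) (8 , 3) (9 , 3) (7 , 2)
x₁ _ _ = λ _ → 7 , 2

x₂ : Fin 8 → Fin 3 → Fin 4 → Form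
x₂ 0F 0F = row (6 , 2) (6 , 1) (6 , 1) (6 , 2)
x₂ 1F 0F = row (6 , 2) (6 , 1) (6 , 1) (6 , 2)
x₂ 1F 1F = row (6 , 2) (5 , 1) (5 , 1) (6 , 2)
x₂ 1F 2F = row (6 , 2) (6 , 2) (4 , 0) (6 , 2)
x₂ 2F 0F = row (6 , 2) (2 , 0) (8 , 2) (6 , 2)
x₂ 2F 1F = row (6 , 2) (4 , 1) (6 , 1) (6 , 2)
x₂ 2F 2F = row (6 , 2) (3 , 0) (7 , 2) (6 , 2)
x₂ 3F 0F = row (6 , 2) (1 , 0) (9 , 2) (6 , 2)
x₂ 3F 1F = row (6 , 2) (0 , 0) (9 , 2) (6 , 2)
x₂ 3F 2F = row (6 , 2) (2 , 1) (11 , 3) (6 , 2)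
x₂ 4F 0F = row (4 , 1) (12 , 3) (6 , 2) (6 , 2)
x₂ 4F 1F = row (5 , 2) (14 , 4) (8 , 2) (6 , 2)
x₂ 4F 2F = row (3 , 1) (12 , 3) (6 , 2) (6 , 2)
x₂ _ _ = λ _ → 6 , 2

x₅ : Fin 8 → Fin 3 → Fin 4 → Form
x₅ 0F 0F = row (5 , 1) (3 , 0) (8 , 2) (5 , 1)
x₅ 0F 1F = row (5 , 1) (5 , 1) (6 , 1) (5 , 1)
x₅ 0F 2F = row (5 , 1) (5 , 1) (6 , 1) (5 , 1)
x₅ 1F 0F = row (5 , 1) (2 , 0) (9 , 2) (5 , 1)
x₅ 1F 1F = row (5 , 1) (0 , 0) (10 , 2) (5 , 1)
x₅ 1F 2F = row (5 , 1) (1 , 1) (11 , 3) (6 , 1)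
x₅ 2F 0F = row (3 , 1) (12 , 3) (7 , 1) (5 , 1)
x₅ 2F 1F = row (4 , 1) (14 , 4) (9 , 2) (5 , 1)
x₅ 2F 2F = row (2 , 1) (12 , 3) (7 , 1) (5 , 1)
x₅ _ _ = λ _ → 5 , 1

-- At rank 5 all edges at the middle ring are assumed absent, and the two upper rings mirror the two
-- lower ones, arm lengths included.
x₅′ : Table
x₅′ s d = x₅ (Fin.opposite s) (opposite d)

cert₁ : Certificate x₁ 4F 0F
cert₁ = from-yes (certificate? x₁ 4F 0F)

cert₂ : Certificate x₂ 3F 1F
cert₂ = from-yes (certificate? x₂ 3F 1F)

cert₅ : Certificate x₅ 1F 1F
cert₅ = from-yes (certificate? x₅ 1F 1F)

cert₅′ : Certificate x₅′ 6F 2F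
cert₅′ = from-yes (certificate? x₅′ 6F 2F)

module Barriers (m t : ℕ) (wide : 14 + 4 * t ≤ 7 + 2 * m) where

  open Base m

  L : ℕ
  L = 14 + 4 * t

  _≟ᴮ_ : DecidableEquality B
  _≟ᴮ_ = ≡-dec _≟_ _≟_

  eval : Form → ℕ
  eval (p , q) = p + q * t

  eval-mono : ∀ {a b} → a ≼ b → eval a ≤ eval b
  eval-mono (p≤ , q≤) = +-mono-≤ p≤ (*-monoˡ-≤ t q≤)

  eval-⊕ : ∀ a b → eval (a ⊕ b) ≡ eval a + eval b
  eval-⊕ (p , q) (p′ , q′) = regroup p q p′ q′ t
    where
    regroup : ∀ p q p′ q′ t → p + p′ + (q + q′) * t ≡ p + q * t + (p′ + q′ * t)
    regroup = solve-∀

  γ : B → Fin 3 → ℕ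
  γ (i , s) d = eval (armForm s d)

  γ-total : ∀ h → total (γ h) ≡ suc t
  γ-total (i , 0F) = simp t
    where
    simp : ∀ t → 1 + 1 * t + (0 + 0 * t + (0 + 0 * t)) ≡ suc t
    simp = solve-∀
  γ-total (i , 1F) = simp t
    where
    simp : ∀ t → 1 + 0 * t + (0 + 0 * t + (0 + 1 * t)) ≡ suc t
    simp = solve-∀
  γ-total (i , 2F) = simp t
    where
    simp : ∀ t → 0 + 0 * t + (1 + 1 * t + (0 + 0 * t)) ≡ suc t
    simp = solve-∀
  γ-total (i , 3F) = simp t
    where
    simp : ∀ t → 0 + 0 * t + (0 + 0 * t + (1 + 1 * t)) ≡ suc t
    simp = solve-∀
  γ-total (i , 4F) = γ-total (i , 2F)
  γ-total (i , 5F) = γ-total (i , 3F)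
  γ-total (i , 6F) = simp t
    where
    simp : ∀ t → 1 + 0 * t + (0 + 1 * t + (0 + 0 * t)) ≡ suc t
    simp = solve-∀
  γ-total (i , 7F) = γ-total (i , 0F)

  positive : Sector → ℕ
  positive zero    = 0
  positive (suc _) = 1

  -- On a cap ring the edge joining the last sector to the first ranks below the others.
  bump : Fin 3 → Sector → ℕ
  bump stay  i = 0
  bump ahead i = positive (next i)
  bump back  i = positive i

  rk : Dart B → ℕ
  rk ((i , s) , d) = rank₀ s d + bump (capTurn s d) i

  rk-α : ∀ d → rk (αᴴ d) ≡ rk d
  rk-α ((i , s) , d) = cong₂ _+_ (rank₀-move s d)
      (trans (cong (λ σ → bump σ (shift (turnOf s d) i)) (capTurn-move s d))
          (bump-opposite (capTurn s d) (capTurn-turn s d)))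
    where
    bump-opposite : ∀ σ → σ ≡ stay ⊎ turnOf s d ≡ σ → bump (opposite σ) (shift (turnOf s d) i) ≡ bump σ i
    bump-opposite stay  _           = refl
    bump-opposite ahead (inj₂ eq) rewrite eq = refl
    bump-opposite back  (inj₂ eq) rewrite eq = cong positive (next-prev i)

  bump≤1 : ∀ σ i → bump σ i ≤ 1
  bump≤1 stay  i = z≤n
  bump≤1 ahead i = positive≤1 (next i)
    where
    positive≤1 : ∀ i → positive i ≤ 1
    positive≤1 zero    = z≤n
    positive≤1 (suc _) = ≤-refl
  bump≤1 back  zero    = z≤n
  bump≤1 back  (suc _) = ≤-refl

  rk<10 : ∀ d → rk d < 10
  rk<10 ((i , s) , d) = s≤s (+-mono-≤ (rank₀≤8 s d) (bump≤1 (capTurn s d) i))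

  rk-low : ∀ i s d → rank₀ s d < 8 → rk ((i , s) , d) ≡ rank₀ s d
  rk-low i s d low rewrite low⇒capTurn≡stay s d low = +-identityʳ _

  relative : Sector → Sector → Fin 4
  relative i j with j ≟ i | j ≟ next i | j ≟ prev i
  ... | yes _ | _     | _     = same
  ... | no  _ | yes _ | _     = after
  ... | no  _ | no  _ | yes _ = before
  ... | no  _ | no  _ | no  _ = elsewhere

  relative-same : ∀ i → relative i i ≡ same
  relative-same i with i ≟ i
  ... | yes _   = refl
  ... | no  i≢i = contradiction refl i≢i

  same-relative : ∀ i j → relative i j ≡ same → j ≡ i
  same-relative i j eq with j ≟ i | j ≟ next i | j ≟ prev i
  ... | yes j≡i | _ | _ = j≡i
  same-relative i j () | no _ | yes _ | _
  same-relative i j () | no _ | no _  | yes _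
  same-relative i j () | no _ | no _  | no _

  relative-next : ∀ i j → follows (relative i j) (relative i (next j)) ≡ true
  relative-next i j with j ≟ i | j ≟ next i | j ≟ prev i | next j ≟ i | next j ≟ next i | next j ≟ prev i
  ... | yes refl | _        | _        | yes eq | _      | _      = contradiction eq (next≢ i)
  ... | yes refl | _        | _        | no _   | yes _  | _      = refl
  ... | yes refl | _        | _        | no _   | no ≢   | _      = contradiction refl ≢
  ... | no _     | yes refl | _        | yes eq | _      | _      = contradiction eq (next²≢ i)
  ... | no _     | yes refl | _        | no _   | yes eq | _      = contradiction eq (next≢ (next i))
  ... | no _     | yes refl | _        | no _   | no _   | yes eq = contradiction (≡prev⇒next≡ eq)
      (next-aperiodic 2 (s≤s (s≤s (s≤s (s≤s z≤n)))) i)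
  ... | no _     | yes refl | _        | no _   | no _   | no _   = refl
  ... | no _     | no _     | yes refl | yes _  | _      | _      = refl
  ... | no _     | no _     | yes refl | no ≢   | _      | _      = contradiction (next-prev i) ≢
  ... | no _     | no _     | no ≢     | yes eq | _      | _      = contradiction
      (trans (≡-sym (prev-next j)) (cong prev eq)) ≢
  ... | no ≢     | no _     | no _     | no _   | yes eq | _      = contradiction (next-injective eq) ≢
  ... | no _     | no _     | no _     | no _   | no _   | yes _  = refl
  ... | no _     | no _     | no _     | no _   | no _   | no _   = refl

  relative-shift : ∀ σ i j → compatible σ (relative i j) (relative i (shift σ j)) ≡ true
  relative-shift stay  i j = dec-true (relative i j ≟ relative i j) refl
  relative-shift ahead i j = relative-next i j
  relative-shift back  i j = subst (λ l → follows (relative i (prev j)) (relative i l) ≡ true) (next-prev j)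
      (relative-next i (prev j))

  Barrierᴴ : Dart B → Set
  Barrierᴴ = Barrier H γ rk L

  module FromTable {T : Table} {s₀ : Fin 8} {d₀ : Fin 3} (cert : Certificate T s₀ d₀) (i : Sector) where

    e₀ : Dart B
    e₀ = (i , s₀) , d₀

    x : Dart B → ℕ
    x ((j , s) , d) = eval (T s d (relative i j))

    rank₀≤7 : rank₀ s₀ d₀ ≤ 7
    rank₀≤7 = proj₂ (proj₂ (proj₂ (proj₂ cert)))

    x-tame : Tame H γ x
    x-tame (j , s) d e = ≤-trans (eval-mono (proj₁ cert s d e (relative i j)))
      (≤-reflexive (trans (eval-⊕ (T s e (relative i j)) _)
        (cong (λ z → eval (T s e (relative i j)) + suc z) (eval-⊕ (armForm s d) (armForm s e)))))

    x-lip : ∀ d → d ≢ e₀ → d ≢ αᴴ e₀ → rk e₀ ≤ rk d → x d ≤ suc (x (αᴴ d))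
    x-lip ((j , s) , d) ≢e ≢αe le
      with proj₁ (proj₂ cert) s d (relative i j) (relative i (shift (turnOf s d) j))
          (relative-shift (turnOf s d) i j)
    ... | inj₂ small = eval-mono small
    ... | inj₁ (inj₁ low) = contradiction
      (≤-trans (≤-reflexive (≡-sym (rk-low i s₀ d₀ (s≤s rank₀≤7))))
          (≤-trans le (≤-reflexive (rk-low j s d (≤-trans low (m≤n⇒m≤1+n rank₀≤7))))))
      (<⇒≱ low)
    ... | inj₁ (inj₂ (inj₁ ((refl , refl) , eq))) = contradiction
        (cong (λ l → (l , s) , d) (same-relative i j eq)) ≢e
    ... | inj₁ (inj₂ (inj₂ ((refl , refl) , eq))) = contradiction
      (trans (≡-sym (αᴴ-involutive ((j , s) , d)))
          (cong (λ l → αᴴ ((l , slotOf s d) , dartOf s d)) (same-relative i _ eq))) ≢αe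

    table-barrier : Barrierᴴ e₀
    table-barrier = x , x-tame , x-lip ,
      ≤-trans (≤-reflexive (trans (cong (λ r → eval (T s₀ d₀ r) + L) (relative-same i))
          (≡-sym (eval-⊕ (T s₀ d₀ same) (14 , 4)))))
        (≤-trans (eval-mono (proj₁ (proj₂ (proj₂ cert))))
          (≤-reflexive (cong (λ r → eval (T (slotOf s₀ d₀) (dartOf s₀ d₀) r)) (≡-sym unmoved))))
      where
      unmoved : relative i (shift (turnOf s₀ d₀) i) ≡ same
      unmoved = trans (cong (λ σ → relative i (shift σ i)) (proj₁ (proj₂ (proj₂ (proj₂ cert)))))
          (relative-same i)

  -- Barriers on the two cap rings

  toℕ-next : ∀ (j : Sector) → next j ≢ zero → toℕ (next j) ≡ suc (toℕ j)
  toℕ-next j ≢0 with view j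
  ... | ‵fromℕ     = contradiction (next-fromℕ _) ≢0
  ... | ‵inject₁ l = trans (cong toℕ (next-inject₁ l)) (cong suc (≡-sym (toℕ-inject₁ l)))

  module CapRing (S : Fin 8) (r l : Fin 3)
    (αr : ∀ j → αᴴ ((j , S) , r) ≡ ((next j , S) , l)) (αl : ∀ j → αᴴ ((j , S) , l) ≡ ((prev j , S) , r))
    (l≢r : l ≢ r) (exhaust : ∀ d → d ≡ r ⊎ d ≡ l ⊎ rank₀ S d ≤ 7)
    (rk-r : ∀ j → rk ((j , S) , r) ≡ 8 + positive (next j))
        (rk-l : ∀ j → rk ((j , S) , l) ≡ 8 + positive j) where

    rk-vertical : ∀ j d → rank₀ S d ≤ 7 → ¬ (8 ≤ rk ((j , S) , d))
    rk-vertical j d low le = <⇒≱ (≤-trans (s≤s (≤-reflexive (rk-low j S d (s≤s low)))) (s≤s low)) le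

    module Wrap where

      e₀ : Dart B
      e₀ = (fromℕ _ , S) , r

      half : Fin 3 → ℕ
      half d with d ≟ r
      ... | yes _ = 1
      ... | no  _ = 0

      -- The distance along the ring from the left dart of sector `zero`. Cap darts carry no arm, so
      -- a sector contributes one edge inside its fragment and one towards the next fragment.
      x : Dart B → ℕ
      x ((j , s) , d) with s ≟ S
      ... | yes _ = half d + 2 * toℕ j
      ... | no  _ = 0

      half≤1 : ∀ d → half d ≤ 1
      half≤1 d with d ≟ r
      ... | yes _ = ≤-refl
      ... | no  _ = z≤n

      half-r : half r ≡ 1
      half-r with r ≟ r
      ... | yes _   = refl
      ... | no  r≢r = contradiction refl r≢r

      half-l : half l ≡ 0
      half-l with l ≟ r
      ... | yes l≡r = contradiction l≡r l≢r
      ... | no  _   = refl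

      x-S : ∀ j d → x ((j , S) , d) ≡ half d + 2 * toℕ j
      x-S j d with S ≟ S
      ... | yes _   = refl
      ... | no  S≢S = contradiction refl S≢S

      x-tame : Tame H γ x
      x-tame (j , s) d e with s ≟ S
      ... | no  _ = z≤n
      ... | yes _ = ≤-trans (+-mono-≤ (half≤1 d) (≤-refl {2 * toℕ j}))
                      (≤-trans (s≤s (≤-trans (m≤n+m (2 * toℕ j) (half e)) (m≤m+n _ _)))
                          (≤-reflexive (≡-sym (+-suc _ _))))

      x-lip : ∀ d → d ≢ αᴴ e₀ → d ≢ αᴴ (αᴴ e₀) → rk (αᴴ e₀) ≤ rk d → x d ≤ suc (x (αᴴ d))
      x-lip ((j , s) , d) _ ≢e le with s ≟ S
      ... | no  _    = z≤n
      ... | yes refl with exhaust d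
      ...   | inj₂ (inj₂ low)  = contradiction
          (≤-trans (≤-trans (m≤m+n 8 _) (≤-reflexive (≡-sym (rk-r (fromℕ _)))))
          (≤-trans (≤-reflexive (≡-sym (rk-α e₀))) le)) (rk-vertical j d low)
      ...   | inj₁ refl        = ≤-trans (≤-reflexive (cong (_+ 2 * toℕ j) half-r)) (s≤s
        (≤-trans (ahead-ok (next j ≟ zero))
            (≤-reflexive (≡-sym (trans (cong x (αr j))
            (trans (x-S (next j) l) (cong (_+ 2 * toℕ (next j)) half-l)))))))
        where
        ahead-ok : Dec (next j ≡ zero) → 2 * toℕ j ≤ 2 * toℕ (next j)
        ahead-ok (no  ≢0) rewrite toℕ-next j ≢0 = *-monoʳ-≤ 2 (n≤1+n (toℕ j))
        ahead-ok (yes ≡0) = contradiction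
            (trans (cong (λ i → (i , S) , r) (next-injective (trans ≡0 (≡-sym (next-fromℕ _)))))
            (≡-sym (αᴴ-involutive e₀))) ≢e
      ...   | inj₂ (inj₁ refl) = ≤-trans (≤-reflexive (cong (_+ 2 * toℕ j) half-l))
        (≤-trans (back-ok j) (s≤s
            (≤-reflexive (≡-sym (trans (cong x (αl j))
            (trans (x-S (prev j) r) (cong (_+ 2 * toℕ (prev j)) half-r)))))))
        where
        back-ok : ∀ j → 2 * toℕ j ≤ suc (suc (2 * toℕ (prev j)))
        back-ok zero    = z≤n
        back-ok (suc j) rewrite toℕ-inject₁ j = ≤-reflexive (*-suc 2 (toℕ j))

      barrier : Barrierᴴ (αᴴ e₀)
      barrier = x , x-tame , x-lip , ≤-trans (≤-reflexive (cong (_+ L) x-start))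
          (≤-trans wide (≤-reflexive (≡-sym x-end)))
        where
        x-start : x (αᴴ e₀) ≡ 0
        x-start = trans (cong x (αr (fromℕ _)))
            (trans (x-S (next (fromℕ _)) l) (cong₂ _+_ half-l (cong (λ j → 2 * toℕ j) (next-fromℕ (3 + m)))))
        x-end : x (αᴴ (αᴴ e₀)) ≡ 7 + 2 * m
        x-end = trans (cong x (αᴴ-involutive e₀))
            (trans (x-S (fromℕ _) r) (cong₂ _+_ half-r (trans (cong (2 *_) (toℕ-fromℕ (3 + m))) (six m))))
          where
          six : ∀ m → 2 * (3 + m) ≡ 6 + 2 * m
          six = solve-∀

    module Chain (i : Sector) (i-inner : next i ≢ zero) where

      e₀ : Dart B
      e₀ = (i , S) , r

      -- With the closing edge absent the ring is a path, on which the edge after sector `i` is a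
      -- bridge; the potential is a step of height `L` there.
      x : Dart B → ℕ
      x ((j , s) , d) with s ≟ S | toℕ i <? toℕ j
      ... | yes _ | yes _ = L
      ... | _     | _     = 0

      x-beyond : ∀ j d → toℕ i < toℕ j → x ((j , S) , d) ≡ L
      x-beyond j d i<j with S ≟ S | toℕ i <? toℕ j
      ... | yes _   | yes _  = refl
      ... | no  S≢S | _      = contradiction refl S≢S
      ... | yes _   | no i≮j = contradiction i<j i≮j

      x-start : x e₀ ≡ 0
      x-start with S ≟ S | toℕ i <? toℕ i
      ... | yes _   | yes i<i = contradiction i<i (n≮n _)
      ... | yes _   | no _    = refl
      ... | no  _   | _       = refl

      positive-next : positive (next i) ≡ 1
      positive-next with next i
      ... | zero  = contradiction refl i-inner
      ... | suc _ = refl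

      x-lip : ∀ d → d ≢ e₀ → d ≢ αᴴ e₀ → rk e₀ ≤ rk d → x d ≤ suc (x (αᴴ d))
      x-lip ((j , s) , d) ≢e ≢αe le with s ≟ S | toℕ i <? toℕ j
      ... | no  _    | _       = z≤n
      ... | yes _    | no _    = z≤n
      ... | yes refl | yes i<j with exhaust d
      ...   | inj₂ (inj₂ low)  = contradiction
          (≤-trans (≤-trans (m≤m+n 8 _) (≤-reflexive (≡-sym (rk-r i)))) le) (rk-vertical j d low)
      ...   | inj₁ refl        = m≤n⇒m≤1+n (≤-reflexive (≡-sym (trans (cong x (αr j)) (x-beyond (next j) l
        (≤-trans i<j (≤-trans (n≤1+n _) (≤-reflexive (≡-sym (toℕ-next j inner)))))))))
        where
        inner : next j ≢ zero
        inner ≡0 = <⇒≱ {8} {9} ≤-refl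
            (≤-trans (≤-reflexive (≡-sym (trans (rk-r i) (cong (8 +_) positive-next))))
          (≤-trans le (≤-reflexive (trans (rk-r j) (cong (λ l → 8 + positive l) ≡0)))))
      ...   | inj₂ (inj₁ refl) = m≤n⇒m≤1+n
          (≤-reflexive (≡-sym (trans (cong x (αl j)) (x-beyond (prev j) r (beyond j i<j ≢αe)))))
        where
        beyond : ∀ j → toℕ i < toℕ j → ((j , S) , l) ≢ αᴴ e₀ → toℕ i < toℕ (prev j)
        beyond (suc j) (s≤s i≤j) ≢αe rewrite toℕ-inject₁ j with m≤n⇒m<n∨m≡n i≤j
        ... | inj₁ i<j = i<j
        ... | inj₂ i≡j = contradiction (≡-sym (trans (αr i) (cong (λ k → (k , S) , l)
          (trans (cong next (toℕ-injective (trans i≡j (≡-sym (toℕ-inject₁ j))))) (next-inject₁ j))))) ≢αe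

      barrier : Barrierᴴ e₀
      barrier = x , (λ h d e → tame h d e) , x-lip , ≤-reflexive (trans (cong (_+ L) x-start)
          (≡-sym (trans (cong x (αr i)) (x-beyond (next i) l (≤-reflexive (≡-sym (toℕ-next i i-inner)))))))
        where
        tame : Tame H γ x
        tame (j , s) d e with s ≟ S | toℕ i <? toℕ j
        ... | yes _ | yes _ = m≤m+n _ _
        ... | yes _ | no _  = z≤n
        ... | no  _ | _     = z≤n

    cap-barrier : ∀ i → Barrierᴴ ((i , S) , r) ⊎ Barrierᴴ (αᴴ ((i , S) , r))
    cap-barrier i with next i ≟ zero
    ... | no  ≢0 = inj₁ (Chain.barrier i ≢0)
    ... | yes ≡0 = inj₂ (subst (λ j → Barrierᴴ (αᴴ ((j , S) , r)))
        (next-injective (trans (next-fromℕ _) (≡-sym ≡0))) Wrap.barrier)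

  -- A barrier for every edge

  lower-darts : ∀ d → d ≡ 2F ⊎ d ≡ 1F ⊎ rank₀ 0F d ≤ 7
  lower-darts 0F = inj₂ (inj₂ ≤-refl)
  lower-darts 1F = inj₂ (inj₁ refl)
  lower-darts 2F = inj₁ refl

  upper-darts : ∀ d → d ≡ 1F ⊎ d ≡ 2F ⊎ rank₀ 7F d ≤ 7
  upper-darts 0F = inj₂ (inj₂ ≤-refl)
  upper-darts 1F = inj₁ refl
  upper-darts 2F = inj₂ (inj₁ refl)

  module LowerCap = CapRing 0F 2F 1F (λ _ → refl) (λ _ → refl) (λ ()) lower-darts (λ _ → refl) (λ _ → refl)
  module UpperCap = CapRing 7F 1F 2F (λ _ → refl) (λ _ → refl) (λ ()) upper-darts (λ _ → refl) (λ _ → refl)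

  -- The dead ends met while peeling. With ranks 1 and 2 gone, slot 4 hangs on its rightward edge;
  -- after rank 3, slot 3 hangs on its vertical edge. After rank 5, slots 2 and 5 hang on one ring
  -- edge each, and after rank 6, slots 1 and 6 hang on their vertical edges.
  pendantᴴ : ∀ i s d → (∀ e → e ≢ d → rank₀ s e < rank₀ s d) → rank₀ s d ≤ 7 → Barrierᴴ (αᴴ ((i , s) , d))
  pendantᴴ i s d others low = pendant H γ rk L _≟ᴮ_ rk-α (i , s) d λ e e≢d →
    subst₂ _<_ (≡-sym (rk-low i s e (≤-trans (others e e≢d) (m≤n⇒m≤1+n low))))
        (≡-sym (rk-low i s d (s≤s low))) (others e e≢d)

  -- bar with subscripts s d treats dart d at slot s.
  Bar : Dart B → Set
  Bar d = Barrierᴴ d ⊎ Barrierᴴ (αᴴ d)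

  flip : ∀ d → Bar (αᴴ d) → Bar d
  flip d (inj₁ p) = inj₂ p
  flip d (inj₂ p) = inj₁ (subst Barrierᴴ (αᴴ-involutive d) p)

  Peak : Fin 8 → Fin 3 → Set
  Peak s d = ∀ e → e ≢ d → rank₀ s e < rank₀ s d

  peak? : ∀ s d → Dec (Peak s d)
  peak? s d = all? λ e → ¬? (e ≟ d) →-dec (rank₀ s e <? rank₀ s d)

  bar₀₂ : ∀ i → Bar ((i , 0F) , 2F)
  bar₀₂ i = LowerCap.cap-barrier i

  bar₇₁ : ∀ i → Bar ((i , 7F) , 1F)
  bar₇₁ i = UpperCap.cap-barrier i

  bar₄₀ : ∀ i → Bar ((i , 4F) , 0F)
  bar₄₀ i = inj₁ (FromTable.table-barrier cert₁ i)

  bar₃₁ : ∀ i → Bar ((i , 3F) , 1F)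
  bar₃₁ i = inj₁ (FromTable.table-barrier cert₂ i)

  bar₁₁ : ∀ i → Bar ((i , 1F) , 1F)
  bar₁₁ i = inj₁ (FromTable.table-barrier cert₅ i)

  bar₆₂ : ∀ i → Bar ((i , 6F) , 2F)
  bar₆₂ i = inj₁ (FromTable.table-barrier cert₅′ i)

  bar₄₂ : ∀ i → Bar ((i , 4F) , 2F)
  bar₄₂ i = inj₂ (pendantᴴ i 4F 2F (from-yes (peak? 4F 2F)) (from-yes (rank₀ 4F 2F ≤? 7)))

  bar₃₀ : ∀ i → Bar ((i , 3F) , 0F)
  bar₃₀ i = inj₂ (pendantᴴ i 3F 0F (from-yes (peak? 3F 0F)) (from-yes (rank₀ 3F 0F ≤? 7)))

  bar₂₂ : ∀ i → Bar ((i , 2F) , 2F)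
  bar₂₂ i = inj₂ (pendantᴴ i 2F 2F (from-yes (peak? 2F 2F)) (from-yes (rank₀ 2F 2F ≤? 7)))

  bar₅₁ : ∀ i → Bar ((i , 5F) , 1F)
  bar₅₁ i = inj₂ (pendantᴴ i 5F 1F (from-yes (peak? 5F 1F)) (from-yes (rank₀ 5F 1F ≤? 7)))

  bar₁₀ : ∀ i → Bar ((i , 1F) , 0F)
  bar₁₀ i = inj₂ (pendantᴴ i 1F 0F (from-yes (peak? 1F 0F)) (from-yes (rank₀ 1F 0F ≤? 7)))

  bar₆₀ : ∀ i → Bar ((i , 6F) , 0F)
  bar₆₀ i = inj₂ (pendantᴴ i 6F 0F (from-yes (peak? 6F 0F)) (from-yes (rank₀ 6F 0F ≤? 7)))

  abstract
    barrier : ∀ d → Bar d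
    barrier ((i , 0F) , 0F) = flip _ (bar₁₀ i)
    barrier ((i , 0F) , 1F) = flip _ (bar₀₂ (prev i))
    barrier ((i , 0F) , 2F) = bar₀₂ i
    barrier ((i , 1F) , 0F) = bar₁₀ i
    barrier ((i , 1F) , 1F) = bar₁₁ i
    barrier ((i , 1F) , 2F) = flip _ (bar₂₂ (prev i))
    barrier ((i , 2F) , 0F) = flip _ (bar₃₀ i)
    barrier ((i , 2F) , 1F) = flip _ (bar₁₁ i)
    barrier ((i , 2F) , 2F) = bar₂₂ i
    barrier ((i , 3F) , 0F) = bar₃₀ i
    barrier ((i , 3F) , 1F) = bar₃₁ i
    barrier ((i , 3F) , 2F) = flip _ (bar₄₂ (prev i))
    barrier ((i , 4F) , 0F) = bar₄₀ i
    barrier ((i , 4F) , 1F) = flip _ (bar₃₁ i)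
    barrier ((i , 4F) , 2F) = bar₄₂ i
    barrier ((i , 5F) , 0F) = flip _ (bar₄₀ i)
    barrier ((i , 5F) , 1F) = bar₅₁ i
    barrier ((i , 5F) , 2F) = flip _ (bar₆₂ i)
    barrier ((i , 6F) , 0F) = bar₆₀ i
    barrier ((i , 6F) , 1F) = flip _ (bar₅₁ (prev i))
    barrier ((i , 6F) , 2F) = bar₆₂ i
    barrier ((i , 7F) , 0F) = flip _ (bar₆₀ i)
    barrier ((i , 7F) , 1F) = bar₇₁ i
    barrier ((i , 7F) , 2F) = flip _ (bar₇₁ (prev i))

-- The graphs

module Relabel {V : Set} {n} (f : Fin n ↔ V) (M : CubicMap V) where
  open Inverse f using (to; from) renaming (strictlyInverseˡ to to-from; strictlyInverseʳ to from-to)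

  toᴰ : Dart (Fin n) → Dart V
  toᴰ (v , i) = to v , i

  fromᴰ : Dart V → Dart (Fin n)
  fromᴰ (v , i) = from v , i

  toᴰ-fromᴰ : ∀ d → toᴰ (fromᴰ d) ≡ d
  toᴰ-fromᴰ (v , i) = cong (_, i) (to-from v)

  fromᴰ-toᴰ : ∀ d → fromᴰ (toᴰ d) ≡ d
  fromᴰ-toᴰ (v , i) = cong (_, i) (from-to v)

  to-injective : ∀ {u w} → to u ≡ to w → u ≡ w
  to-injective {u} {w} eq = trans (≡-sym (from-to u)) (trans (cong from eq) (from-to w))

  from-injective : ∀ {u w} → from u ≡ from w → u ≡ w
  from-injective {u} {w} eq = trans (≡-sym (to-from u)) (trans (cong to eq) (to-from w))

  M° : CubicMap (Fin n)
  M° = record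
    { α          = fromᴰ ∘ α M ∘ toᴰ
    ; involutive = λ d → trans (cong (fromᴰ ∘ α M) (toᴰ-fromᴰ (α M (toᴰ d))))
        (trans (cong fromᴰ (involutive M (toᴰ d))) (fromᴰ-toᴰ d))
    ; loopless   = λ d eq → loopless M (toᴰ d) (trans (≡-sym (to-from _)) (cong to eq))
    ; simple     = λ d e p q → trans (≡-sym (fromᴰ-toᴰ d))
        (trans (cong fromᴰ (simple M (toᴰ d) (toᴰ e) (cong to p) (from-injective q))) (fromᴰ-toᴰ e))
    }

  α-fromᴰ : ∀ d → α M° (fromᴰ d) ≡ fromᴰ (α M d)
  α-fromᴰ d = cong (fromᴰ ∘ α M) (toᴰ-fromᴰ d)

  step-fromᴰ : ∀ d → step M° (fromᴰ d) ≡ fromᴰ (step M d)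
  step-fromᴰ d = cong turn (α-fromᴰ d)

  faces° : ∀ {L F} → Fin F ↔ L → Faces M L → Faces M° (Fin F)
  faces° g φ = record
    { face        = Inverse.from g ∘ face ∘ toᴰ
    ; face-step   = λ d → cong (Inverse.from g)
        (trans (cong (face ∘ turn) (toᴰ-fromᴰ (α M (toᴰ d)))) (face-step (toᴰ d)))
    ; face-orbit  = λ d e eq → subst₂ (Star (_⟶_ M°)) (fromᴰ-toᴰ d) (fromᴰ-toᴰ e)
        (gmap fromᴰ (λ { {x} refl → step-fromᴰ x }) (face-orbit (toᴰ d) (toᴰ e)
          (trans (≡-sym (Inverse.strictlyInverseˡ g _))
              (trans (cong (Inverse.to g) eq) (Inverse.strictlyInverseˡ g _)))))
    ; onFace      = fromᴰ ∘ onFace ∘ Inverse.to g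
    ; face-onFace = λ l →
        trans (cong (Inverse.from g) (trans (cong face (toᴰ-fromᴰ _)) (face-onFace (Inverse.to g l))))
        (Inverse.strictlyInverseʳ g l)
    }
    where open Faces φ

  connected° : Connected₃ M → Connected₃ M°
  connected° conn a b u w (u≢a , u≢b) (w≢a , w≢b) = subst₂ (Star (Link M° a b)) (from-to u) (from-to w)
      (gmap from relink (conn (to a) (to b) (to u) (to w) (u≢a ∘ to-injective , u≢b ∘ to-injective)
          (w≢a ∘ to-injective , w≢b ∘ to-injective)))
    where
    avoid : ∀ {x} → Avoids (to a) (to b) x → Avoids a b (from x)
    avoid (p , q) = (λ eq → p (trans (≡-sym (to-from _)) (cong to eq))) , λ eq → q
        (trans (≡-sym (to-from _)) (cong to eq))
    relink : ∀ {x y} → Link M (to a) (to b) x y → Link M° a b (from x) (from y)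
    relink (link d p q) = subst (λ e → Link M° a b (from (proj₁ d)) (proj₁ e)) (α-fromᴰ d)
      (link (fromᴰ d) (avoid p) (subst (Avoids a b ∘ proj₁) (≡-sym (α-fromᴰ d)) (avoid q)))

  sum-indicator≤1 : (_≟ⱽ_ : DecidableEquality V) → ∀ h → sum (indicator _≟ⱽ_ h ∘ to) ≤ 1
  sum-indicator≤1 _≟ⱽ_ h = ≤-trans (≤-reflexive (≡-sym (count-sum (λ v → does (to v ≟ⱽ h)))))
    (covering⇒count≤ {1} (λ v → does (to v ≟ⱽ h)) (λ _ → from h)
      λ v eq → zero , to-injective (trans (to-from h) (≡-sym (dec-witness (to v ≟ⱽ h) eq))))

sum-ones : ∀ n → sum {n} (λ _ → 1) ≡ n
sum-ones n = trans (sum-const {n} (λ _ → 1) 1 (λ _ → refl)) (*-identityʳ n)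

module Construction (t i : ℕ) where

  -- There are `4 + m = k + 2 + i` sectors. The cycle along a cap may use only two vertices per
  -- fragment, so `k + 2` is the least number of sectors that takes it beyond `2 k + 2`; `i`
  -- provides the infinite family.
  m : ℕ
  m = 4 + (2 * t + i)

  wide : 14 + 4 * t ≤ 7 + 2 * m
  wide = ≤-trans (m≤m+n _ (suc (2 * i))) (≤-reflexive (eq t i))
    where
    eq : ∀ t i → 14 + 4 * t + suc (2 * i) ≡ 7 + 2 * (4 + (2 * t + i))
    eq = solve-∀

  open Base m
  open Barriers m t wide
  open Relabel (*↔× {4 + m} {8}) H
  open Inverse (*↔× {4 + m} {8}) using (to; from) renaming
      (strictlyInverseˡ to to-from; strictlyInverseʳ to from-to)

  n₀ : ℕ
  n₀ = (4 + m) * 8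

  -- A fragment takes one truncation of its vertex and `1 + t` of its arms, each adding two
  -- vertices: `1 + 2 (2 + t) = 5 + 2 t = k - 1`.
  K : (B → ℕ) → ℕ
  K c = sum (c ∘ to) * (5 + 2 * t)

  start : Expansion H γ K n₀
  start = record
    { M         = M°
    ; site      = fresh ∘ γ ∘ to
    ; colour    = to
    ; ι         = fromᴰ
    ; ι-α       = α-fromᴰ
    ; colour-ι  = to-from ∘ proj₁
    ; crossing  = λ d → inj₁ (toᴰ d , ≡-sym (fromᴰ-toᴰ d))
    -- Before any truncation every vertex has a colour of its own, so by looplessness no edge joins
    -- equal colours, and tameness is the slack condition itself.
    ; extend    = λ x tame → x ∘ toᴰ , (λ d → cong x (toᴰ-fromᴰ d)) , (λ v → tame (to v)) ,
                  λ d eq → contradiction (≡-sym (trans eq (to-from _))) (loopless H (toᴰ d))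
    ; mass      = λ c → trans (sum-cong λ v → cong (c (to v) *_) (size (γ-total (to v))))
        (sum-*-distribʳ (c ∘ to) (5 + 2 * t))
    ; faces     = faces° ((↔-id (Fin 2) ⊎-↔ *↔×) ↔-∘ +↔⊎) facesᴴ
    ; euler     = double m
    ; connected = connected° connectedᴴ
    }
    where
    size : ∀ {b} → b ≡ suc t → suc (2 * suc b) ≡ 5 + 2 * t
    size refl = eq t
      where
      eq : ∀ t → suc (2 * suc (suc t)) ≡ 5 + 2 * t
      eq = solve-∀
    double : ∀ m → 2 * (2 + (4 + m) * 4) ≡ (4 + m) * 8 + 4
    double = solve-∀

  abstract
    result : Σ ℕ λ N → Σ (Expansion H γ K N) (Finished H γ)
    result = finish H γ start

  N = proj₁ result
  X = proj₁ (proj₂ result)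
  done = proj₂ (proj₂ result)

  open Expansion X
  open MapGraph M
  open Gap H γ rk L rk-α rk<10 barrier X done

  N≡ : N ≡ n₀ * (5 + 2 * t)
  N≡ = begin
    N                                                ≡⟨ *-identityʳ N ⟨
    N * 1
        ≡⟨ sum-const _ 1 (λ v → trans (+-identityʳ _) (cong (λ b → suc (2 * b)) (done v))) ⟨
    sum (λ v → 1 * suc (2 * budget (site v)))        ≡⟨ mass (λ _ → 1) ⟩
    sum {n₀} (λ _ → 1) * (5 + 2 * t)                 ≡⟨ cong (_* (5 + 2 * t)) (sum-ones n₀) ⟩
    n₀ * (5 + 2 * t)                                 ∎
    where open ≡-Reasoning

  3<N : 3 < N
  3<N = ≤-trans (≤-trans (s≤s (s≤s (s≤s (s≤s z≤n)))) (m≤m*n n₀ (5 + 2 * t))) (≤-reflexive (≡-sym N≡))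

  fragment-size : ∀ h → K (indicator _≟ᴮ_ h) ≤ 5 + 2 * t
  fragment-size h = ≤-trans (*-monoˡ-≤ (5 + 2 * t) (sum-indicator≤1 _≟ᴮ_ h))
      (≤-reflexive (*-identityˡ (5 + 2 * t)))

  short⊎long : ∀ ℓ → Cycle graph ℓ → ℓ ≤ 5 + 2 * t ⊎ L < ℓ
  short⊎long zero    C with () ← Cycle.len≥3 C
  short⊎long (suc ℓ) C = Sum.map₁
    (λ mono → ≤-trans (OnCycle.short C _≟ᴮ_ mono) (fragment-size (colour (Cycle.vert C zero))))
    (OnCycle.monochromatic⊎long C)

Good : ℕ → Graph → Set
Good k G = KConnected 3 G × Cubic G × Planar G × CircumferenceAtLeast G k ×
           (∀ ℓ → k ≤ ℓ → ℓ ≤ 2 * k + 2 → ¬ InCycleSpectrum G ℓ)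

construct : ∀ t (i : ℕ) → Good (6 + 2 * t) (MapGraph.graph (Expansion.M (Construction.X t i)))
construct t i = graph-3-connected 3<N connected , graph-cubic , graph-planar faces euler ,
    (let ℓ , long , C = long-cycle ((zero , zero) , zero) in ℓ , ≤-trans (≤-trans (m≤m+n _ _) (≤-reflexive (eq₁ t))) (<⇒≤ long) , C) ,
    gap
  where
  open Construction t i
  open Expansion X
  open MapGraph M
  open Barriers m t wide using (L; rk; rk-α; rk<10; barrier; γ)
  open Gap (Base.H m) γ rk L rk-α rk<10 barrier X done using (long-cycle)
  eq₁ : ∀ t → 6 + 2 * t + (8 + 2 * t) ≡ 14 + 4 * t
  eq₁ = solve-∀
  eq₂ : ∀ t → 2 * (6 + 2 * t) + 2 ≡ 14 + 4 * t
  eq₂ = solve-∀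
  gap : ∀ ℓ → 6 + 2 * t ≤ ℓ → ℓ ≤ 2 * (6 + 2 * t) + 2 → ¬ Cycle graph ℓ
  gap ℓ k≤ℓ ℓ≤ C = [ (λ short → <⇒≱ (s≤s short) k≤ℓ) ,
      (λ long → <⇒≱ long (≤-trans ℓ≤ (≤-reflexive (eq₂ t)))) ]′
    (short⊎long ℓ C)

Iso⇒order≡ : ∀ {G H} → Iso G H → order G ≡ order H
Iso⇒order≡ iso = ≤-antisym
    (injective⇒≤ {f = to} λ {x} {y} eq → trans (≡-sym (from-to x)) (trans (cong from eq) (from-to y)))
    (injective⇒≤ {f = from} λ {x} {y} eq → trans (≡-sym (to-from x)) (trans (cong to eq) (to-from y)))
  where open Iso iso

-- The order is `(8 + 2 t + i) * 8 * (5 + 2 t)`, so it alone tells the graphs of the family apart.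
order-injective : ∀ t i j → Construction.N t i ≡ Construction.N t j → i ≡ j
order-injective t i j eq = +-cancelˡ-≡ (8 + 2 * t) i j (*-cancelʳ-≡ _ _ 8 (*-cancelʳ-≡ _ _ (5 + 2 * t)
  (trans (≡-sym (Construction.N≡ t i)) (trans eq (Construction.N≡ t j)))))

half : ∀ k → 2 ∣ k → 6 ≤ k → Σ ℕ λ t → 6 + 2 * t ≡ k
half k (divides (suc (suc (suc t))) refl) _ = t , eq t
  where
  eq : ∀ t → 6 + 2 * t ≡ suc (suc (suc t)) * 2
  eq = solve-∀
half k (divides 0 refl) ()
half k (divides 1 refl) (s≤s (s≤s ()))
half k (divides 2 refl) (s≤s (s≤s (s≤s (s≤s ()))))

mainTheorem1 : ∀ (k : ℕ) → 2 ∣ k → 6 ≤ k →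
    Σ (ℕ → Graph) λ G →
    (∀ i → KConnected 3 (G i) × Cubic (G i) × Planar (G i)
    × CircumferenceAtLeast (G i) k
    × (∀ ℓ → k ≤ ℓ → ℓ ≤ 2 * k + 2 → ¬ InCycleSpectrum (G i) ℓ))
    × (∀ i j → ¬ i ≡ j → ¬ Iso (G i) (G j))
mainTheorem1 k even 6≤k with t , refl ← half k even 6≤k =
  (λ i → MapGraph.graph (Expansion.M (Construction.X t i))) , construct t ,
  λ i j i≢j iso → i≢j (order-injective t i j (Iso⇒order≡ iso))
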